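{- Every sequence $S \in \mathbf{C}$ that is $\Sigma^0_1$ or $\Pi^0_1$ satisfies $\dim(S) = 0$.
   Context: Strings are elements of $\{0,1\}^*$; $\mathbf{C}$ (Cantor space) is the set of all infinite binary sequences $S = S[0]S[1]S[2]\ldots$; $S[0..n-1]$ is the string of the first $n$ bits of $S$. A function $f : D \to \mathbb{R}$ on a discrete domain $D$ (such as $\mathbb{N}$ or $\{0,1\}^*$) is lower semicomputable if there is a computable $\hat f : D \times \mathbb{N} \to \mathbb{Q}$ with $\hat f(x,t) \le \hat f(x,t+1) < f(x)$ for all $x,t$ and $\lim_{t\to\infty} \hat f(x,t) = f(x)$ for all $x$. For $s \in [0,\infty)$, an $s$-supergale is a function $d : \{0,1\}^* \to [0,\infty)$ such that $d(w) \ge 2^{ -s}[d(w0)+d(w1)]$ for all $w \in \{0,1\}^*$. It is constructive if it is lower semicomputable. It succeeds on $S \in \mathbf{C}$ if $\limsup_{n\to\infty} d(S[0..n-1]) = \infty$; $S^\infty[d]$ is the set of all $S \in \mathbf{C}$ on which $d$ succeeds. For $X \subseteq \mathbf{C}$, the constructive dimension $\mathrm{cdim}(X)$ is the infimum of all $s \in [0,\infty)$ for which there is a constructive $s$-supergale $d$ with $X \subseteq S^\infty[d]$. The dimension of $S \in \mathbf{C}$ is $\dim(S) = \mathrm{cdim}(\{S\})$. A sequence $S$ is $\Sigma^0_1$ if $\{n \in \mathbb{N} : S[n] = 1\}$ is computably enumerable, and $\Pi^0_1$ if $\{n \in \mathbb{N} : S[n] = 0\}$ is computably enumerable. -}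

module Defs where

open import Algebra.Bundles using (CommutativeRing)
import Algebra.Properties.Semiring.Exp
open import Data.Bool.Base using (Bool; true; false; if_then_else_)
open import Data.Fin.Base using (Fin)
open import Data.Integer.Base as ℤ using (ℤ; +_; -[1+_])
import Data.Integer.Properties as ℤₚ
open import Data.List.Base using (List; []; _∷_; _∷ʳ_; applyUpTo)
open import Data.Nat.Base as ℕ using (ℕ; zero; suc)
import Data.Nat.Properties as ℕₚ
open import Data.Product.Base using (∃-syntax; _×_; _,_)
open import Data.Rational.Base as ℚ using (ℚ; 0ℚ; 1ℚ; ½; ↥_; ↧_; ↧ₙ_)
import Data.Rational.Properties as ℚₚ
open import Data.Sum.Base using (_⊎_; inj₁; inj₂)
open import Data.Vec.Base as Vec using (Vec; []; _∷_)
open import Data.Vec.Relation.Binary.Pointwise.Inductive using (Pointwise)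
open import Function.Bundles using (_⇔_)
open import Relation.Binary.PropositionalEquality
  using (_≡_; _≗_; refl; sym; trans; cong; subst; subst₂)
open import Relation.Binary.Definitions using (tri<; tri≈; tri>)
open import Relation.Nullary using (yes; no; contradiction)
open import Relation.Unary using (Pred; _∈_; _∉_)
open import Level using (0ℓ)

open Algebra.Properties.Semiring.Exp (CommutativeRing.semiring ℚₚ.+-*-commutativeRing)
  using (^-assocʳ) renaming (_^_ to _^ℚ_) public

-- Dedekind's real numbers: a real is the set of all rationals strictly
-- below it (inhabited, bounded above, downward closed, no greatest element).

record ℝ : Set₁ where
  field
    lower     : Pred ℚ 0ℓ
    inhabited : ∃[ q ] q ∈ lower
    proper    : ∃[ q ] q ∉ lower
    closed    : ∀ {p q} → p ℚ.< q → q ∈ lower → p ∈ lower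
    open′     : ∀ {p} → p ∈ lower → ∃[ q ] (p ℚ.< q × q ∈ lower)

open ℝ public

infix 4 _≤_ _<_

_≤_ : ℝ → ℝ → Set
x ≤ y = ∀ {q} → q ∈ lower x → q ∈ lower y

-- Proper inclusion of cuts, with the rational that separates them.
_<_ : ℝ → ℝ → Set
x < y = ∃[ q ] (q ∉ lower x × q ∈ lower y)

sup : (V : Pred ℚ 0ℓ) → ∃[ v ] v ∈ V → ∃[ b ] (∀ {v} → v ∈ V → v ℚ.≤ b) → ℝ
sup V (v₀ , v₀∈V) (b , v≤b) = record
  { lower     = λ p → ∃[ v ] (v ∈ V × p ℚ.< v)
  ; inhabited = v₀ ℚ.- 1ℚ , v₀ , v₀∈V , v-1<v
  ; proper    = b , λ (v , v∈V , b<v) → ℚₚ.<-irrefl refl (ℚₚ.<-≤-trans b<v (v≤b v∈V))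
  ; closed    = λ p<q (v , v∈V , q<v) → v , v∈V , ℚₚ.<-trans p<q q<v
  ; open′     = λ (v , v∈V , p<v) → let (m , p<m , m<v) = ℚₚ.<-dense p<v in
                  m , p<m , v , v∈V , m<v
  }
  where
  v-1<v : v₀ ℚ.- 1ℚ ℚ.< v₀
  v-1<v = subst (v₀ ℚ.- 1ℚ ℚ.<_) (ℚₚ.+-identityʳ v₀)
            (ℚₚ.+-monoʳ-< v₀ (ℚₚ.negative⁻¹ (ℚ.- 1ℚ)))

fromℚ : ℚ → ℝ
fromℚ q = sup (_≡ q) (q , refl) (q , ℚₚ.≤-reflexive)

0ℝ : ℝ
0ℝ = fromℚ 0ℚ

lower<upper : ∀ x {p q} → p ∈ lower x → q ∉ lower x → p ℚ.< q
lower<upper x {p} {q} p∈x q∉x with ℚₚ.<-cmp p q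
... | tri< p<q _ _  = p<q
... | tri≈ _ refl _ = contradiction p∈x q∉x
... | tri> _ _ q<p  = contradiction (closed x q<p p∈x) q∉x

infixl 6 _+_
infixl 7 _*_
infix  8 -_

-_ : ℝ → ℝ
- x = sup (λ v → ∃[ q ] (q ∉ lower x × v ≡ ℚ.- q))
          (let (q , q∉x) = proper x in ℚ.- q , q , q∉x , refl)
          (let (p , p∈x) = inhabited x in
           ℚ.- p , λ { (q , q∉x , refl) → ℚₚ.<⇒≤ (ℚₚ.neg-antimono-< (lower<upper x p∈x q∉x)) })

_+_ : ℝ → ℝ → ℝ
x + y = sup (λ v → ∃[ p ] ∃[ q ] (p ∈ lower x × q ∈ lower y × v ≡ p ℚ.+ q))
            (let (p , p∈x) = inhabited x ; (q , q∈y) = inhabited y in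
             p ℚ.+ q , p , q , p∈x , q∈y , refl)
            (let (a , a∉x) = proper x ; (b , b∉y) = proper y in
             a ℚ.+ b , λ { (p , q , p∈x , q∈y , refl) →
               ℚₚ.<⇒≤ (ℚₚ.+-mono-< (lower<upper x p∈x a∉x) (lower<upper y q∈y b∉y)) })

-- The product of nonnegative reals. (If x or y is negative this is 0.)
_*_ : ℝ → ℝ → ℝ
x * y = sup V (0ℚ , inj₁ refl) (a ℚ.* b ℚ.⊔ 0ℚ , bound)
  where
  V : Pred ℚ 0ℓ
  V v = v ≡ 0ℚ ⊎
        ∃[ p ] ∃[ q ] (p ∈ lower x × q ∈ lower y × 0ℚ ℚ.≤ p × 0ℚ ℚ.≤ q × v ≡ p ℚ.* q)

  a b : ℚ
  a = let (a , _) = proper x in a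
  b = let (b , _) = proper y in b

  bound : ∀ {v} → v ∈ V → v ℚ.≤ a ℚ.* b ℚ.⊔ 0ℚ
  bound (inj₁ refl) = ℚₚ.p≤q⊔p (a ℚ.* b) 0ℚ
  bound (inj₂ (p , q , p∈x , q∈y , 0≤p , 0≤q , refl)) =
    let (_ , a∉x) = proper x
        (_ , b∉y) = proper y
        p≤a = ℚₚ.<⇒≤ (lower<upper x p∈x a∉x)
        q≤b = ℚₚ.<⇒≤ (lower<upper y q∈y b∉y)
        instance
          p⁺ = ℚ.nonNegative 0≤p
          b⁺ = ℚ.nonNegative (ℚₚ.≤-trans 0≤q q≤b)
    in ℚₚ.≤-trans (ℚₚ.*-monoˡ-≤-nonNeg p q≤b)
         (ℚₚ.≤-trans (ℚₚ.*-monoʳ-≤-nonNeg b p≤a) (ℚₚ.p≤p⊔q (a ℚ.* b) 0ℚ))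

2ℚ : ℚ
2ℚ = 1ℚ ℚ.+ 1ℚ

infix 8 2^ℤ_ 2^_

2^ℤ_ : ℤ → ℚ
2^ℤ (+ n)    = 2ℚ ^ℚ n
2^ℤ -[1+ n ] = ½ ^ℚ suc n

^-nonNeg : ∀ {p} → 0ℚ ℚ.≤ p → ∀ n → 0ℚ ℚ.≤ p ^ℚ n
^-nonNeg 0≤p zero    = ℚₚ.nonNegative⁻¹ 1ℚ
^-nonNeg {p} 0≤p (suc n) =
  let instance
        p⁺  = ℚ.nonNegative 0≤p
        pⁿ⁺ = ℚ.nonNegative (^-nonNeg 0≤p n)
        r⁺  = ℚₚ.nonNeg*nonNeg⇒nonNeg p (p ^ℚ n)
  in ℚₚ.nonNegative⁻¹ (p ℚ.* p ^ℚ n)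

*-mono : ∀ {p q r s} → 0ℚ ℚ.≤ p → 0ℚ ℚ.≤ s → p ℚ.≤ q → r ℚ.≤ s → p ℚ.* r ℚ.≤ q ℚ.* s
*-mono {p} {q} {r} {s} 0≤p 0≤s p≤q r≤s =
  let instance
        p⁺ = ℚ.nonNegative 0≤p
        s⁺ = ℚ.nonNegative 0≤s
  in ℚₚ.≤-trans (ℚₚ.*-monoˡ-≤-nonNeg p r≤s) (ℚₚ.*-monoʳ-≤-nonNeg s p≤q)

1≤^ : ∀ {p} → 1ℚ ℚ.≤ p → ∀ n → 1ℚ ℚ.≤ p ^ℚ n
1≤^ 1≤p zero    = ℚₚ.≤-refl
1≤^ 1≤p (suc n) = *-mono {1ℚ} (ℚₚ.nonNegative⁻¹ 1ℚ) (^-nonNeg (ℚₚ.≤-trans (ℚₚ.nonNegative⁻¹ 1ℚ) 1≤p) n)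
                    1≤p (1≤^ 1≤p n)

½^≤1 : ∀ n → ½ ^ℚ n ℚ.≤ 1ℚ
½^≤1 zero    = ℚₚ.≤-refl
½^≤1 (suc n) = *-mono {½} {1ℚ} (ℚₚ.nonNegative⁻¹ ½) (ℚₚ.nonNegative⁻¹ 1ℚ)
                 (ℚₚ.≤ᵇ⇒≤ _) (½^≤1 n)

1≤2 : 1ℚ ℚ.≤ 2ℚ
1≤2 = ℚₚ.≤ᵇ⇒≤ _

0≤2 : 0ℚ ℚ.≤ 2ℚ
0≤2 = ℚₚ.≤ᵇ⇒≤ _

2^-* : ∀ b n → 2ℚ ^ℚ (b ℕ.* n) ≡ (2ℚ ^ℚ n) ^ℚ b
2^-* b n = trans (cong (2ℚ ^ℚ_) (ℕₚ.*-comm b n)) (sym (^-assocʳ 2ℚ n b))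

2^-mono : ∀ {m n} → m ℕ.≤ n → 2ℚ ^ℚ m ℚ.≤ 2ℚ ^ℚ n
2^-mono {n = n} ℕ.z≤n = 1≤^ 1≤2 n
2^-mono {suc m} {suc n} (ℕ.s≤s m≤n) =
  *-mono {2ℚ} {2ℚ} 0≤2 (^-nonNeg 0≤2 n) ℚₚ.≤-refl (2^-mono m≤n)

2^ℤ-mono : ∀ {a} n → a ℤ.≤ + n → 2^ℤ a ℚ.≤ 2ℚ ^ℚ n
2^ℤ-mono {+ m}      n (ℤ.+≤+ m≤n) = 2^-mono m≤n
2^ℤ-mono { -[1+ m ]} n _ = ℚₚ.≤-trans (½^≤1 (suc m)) (1≤^ 1≤2 n)

^-cancel-≤ : ∀ {p q} b → 0ℚ ℚ.≤ q → p ^ℚ suc b ℚ.≤ q ^ℚ suc b → p ℚ.≤ q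
^-cancel-≤ {p} {q} b 0≤q pᵇ≤qᵇ with p ℚₚ.≤? q
... | yes p≤q = p≤q
... | no  p≰q = contradiction (ℚₚ.<-≤-trans (lt b) pᵇ≤qᵇ) (ℚₚ.<-irrefl refl)
  where
  q<p = ℚₚ.≰⇒> p≰q
  instance
    q⁺ = ℚ.nonNegative 0≤q
    p⁺ = ℚ.positive (ℚₚ.≤-<-trans 0≤q q<p)
  lt : ∀ b → q ^ℚ suc b ℚ.< p ^ℚ suc b
  lt zero    = subst₂ ℚ._<_ (sym (ℚₚ.*-identityʳ q)) (sym (ℚₚ.*-identityʳ p)) q<p
  lt (suc b) = ℚₚ.≤-<-trans (ℚₚ.*-monoˡ-≤-nonNeg q (ℚₚ.<⇒≤ (lt b)))
                 (ℚₚ.*-monoˡ-<-pos (p ^ℚ suc b) {{ppos b}} q<p)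
    where
    ppos : ∀ b → ℚ.Positive (p ^ℚ suc b)
    ppos b = ℚ.positive (ℚₚ.≤-<-trans (^-nonNeg 0≤q (suc b)) (lt b))

↥≤ : ∀ {r c} → r ℚ.< c → ↥ r ℤ.≤ + (↧ₙ r ℕ.* ℤ.∣ ↥ c ∣)
↥≤ {r} {c} (ℚ.*<* lt) = go (↥ r) (↥ c) lt
  where
  go : ∀ a e → a ℤ.* ↧ c ℤ.< e ℤ.* ↧ r → a ℤ.≤ + (↧ₙ r ℕ.* ℤ.∣ e ∣)
  go -[1+ _ ] e        _  = ℤ.-≤+
  go (+ a)    (+ e)    lt = ℤ.+≤+ (ℕₚ.≤-trans (ℕₚ.m≤m*n a (↧ₙ c))
    (subst (a ℕ.* ↧ₙ c ℕ.≤_) (ℕₚ.*-comm e (↧ₙ r))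
      (ℕₚ.<⇒≤ (ℤₚ.drop‿+<+ (subst₂ ℤ._<_ (sym (ℤₚ.pos-* a (↧ₙ c))) (sym (ℤₚ.pos-* e (↧ₙ r))) lt)))))
  go (+ a)    -[1+ e ] lt =
    contradiction (subst (ℤ._< -[1+ e ] ℤ.* ↧ r) (sym (ℤₚ.pos-* a (↧ₙ c))) lt) λ ()

2^ℤ-nonNeg : ∀ a → 0ℚ ℚ.≤ 2^ℤ a
2^ℤ-nonNeg (+ n)    = ^-nonNeg 0≤2 n
2^ℤ-nonNeg -[1+ n ] = ^-nonNeg (ℚₚ.nonNegative⁻¹ ½) (suc n)

-- 2^x = sup { p ≥ 0 : p ≤ 2^(a/b) for some rational a/b < x }, where
-- p ≤ 2^(a/b) is expressed as p^b ≤ 2^a.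
2^_ : ℝ → ℝ
2^ x = sup V nonempty (2ℚ ^ℚ N , bound)
  where
  V : Pred ℚ 0ℓ
  V p = 0ℚ ℚ.≤ p × ∃[ r ] (r ∈ lower x × p ^ℚ (↧ₙ r) ℚ.≤ 2^ℤ (↥ r))

  nonempty : ∃[ v ] v ∈ V
  nonempty =
    let (r , r∈x) = inhabited x in
    0ℚ , ℚₚ.≤-refl , r , r∈x ,
    subst (ℚ._≤ 2^ℤ (↥ r)) (sym (ℚₚ.*-zeroˡ (0ℚ ^ℚ ℚ.denominator-1 r))) (2^ℤ-nonNeg (↥ r))

  N : ℕ
  N = let (c , _) = proper x in ℤ.∣ ↥ c ∣

  bound : ∀ {v} → v ∈ V → v ℚ.≤ 2ℚ ^ℚ N
  bound (_ , r , r∈x , pᵇ≤2ᵃ) =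
    let (_ , c∉x) = proper x in
    ^-cancel-≤ (ℚ.denominator-1 r) (^-nonNeg 0≤2 N)
      (ℚₚ.≤-trans pᵇ≤2ᵃ
        (subst (2^ℤ (↥ r) ℚ.≤_) (2^-* (↧ₙ r) N)
          (2^ℤ-mono (↧ₙ r ℕ.* N) (↥≤ (lower<upper x r∈x c∉x)))))

-- Convergence in the order topology: a is eventually above every y < x and
-- eventually below every y > x. (Without excluded middle this is weaker than
-- ∣a t - x∣ < ε eventually, with which it agrees classically.)
Converges : (ℕ → ℚ) → ℝ → Set₁
Converges a x =
  (∀ y → y < x → ∃[ T ] (∀ t → T ℕ.≤ t → y < fromℚ (a t))) ×
  (∀ y → x < y → ∃[ T ] (∀ t → T ℕ.≤ t → fromℚ (a t) < y))

LimsupInfinite : (ℕ → ℝ) → Set₁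
LimsupInfinite a = ∀ (y : ℝ) n → ∃[ m ] (n ℕ.≤ m × y < a m)

record IsInfimum (P : ℝ → Set₁) (x : ℝ) : Set₁ where
  field
    lowerBound : ∀ s → P s → x ≤ s
    greatest   : ∀ y → (∀ s → P s → y ≤ s) → y ≤ x

-- Kleene's partial recursive functions.
data Code : ℕ → Set where
  zeroᶜ : ∀ {n} → Code n
  sucᶜ  : Code 1
  projᶜ : ∀ {n} → Fin n → Code n
  compᶜ : ∀ {n k} → Code k → Vec (Code n) k → Code n
  precᶜ : ∀ {n} → Code n → Code (suc (suc n)) → Code (suc n)
  minᶜ  : ∀ {n} → Code (suc n) → Code n

infix 4 _[_]⇓_

data _[_]⇓_ : ∀ {n} → Code n → Vec ℕ n → ℕ → Set where
  ⇓zero  : ∀ {n} {xs : Vec ℕ n} → zeroᶜ [ xs ]⇓ 0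
  ⇓suc   : ∀ {x} → sucᶜ [ x ∷ [] ]⇓ suc x
  ⇓proj  : ∀ {n} {xs : Vec ℕ n} {i} → projᶜ i [ xs ]⇓ Vec.lookup xs i
  ⇓comp  : ∀ {n k} {f : Code k} {gs : Vec (Code n) k} {xs ys z} →
           Pointwise (λ g y → g [ xs ]⇓ y) gs ys → f [ ys ]⇓ z →
           compᶜ f gs [ xs ]⇓ z
  ⇓prec₀ : ∀ {n} {f : Code n} {g xs z} →
           f [ xs ]⇓ z → precᶜ f g [ 0 ∷ xs ]⇓ z
  ⇓precₛ : ∀ {n} {f : Code n} {g m xs y z} →
           precᶜ f g [ m ∷ xs ]⇓ y → g [ m ∷ y ∷ xs ]⇓ z →
           precᶜ f g [ suc m ∷ xs ]⇓ z
  ⇓min   : ∀ {n} {f : Code (suc n)} {xs m} →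
           (∀ i → i ℕ.< m → ∃[ y ] (f [ i ∷ xs ]⇓ suc y)) → f [ m ∷ xs ]⇓ 0 →
           minᶜ f [ xs ]⇓ m

Computable : ∀ {n} → (Vec ℕ n → ℕ) → Set
Computable {n} f = ∃[ e ] (∀ (xs : Vec ℕ n) → e [ xs ]⇓ f xs)

-- Empty, or the range of a total computable function.
ComputablyEnumerable : Pred ℕ 0ℓ → Set
ComputablyEnumerable A =
  (∀ n → n ∉ A) ⊎
  ∃[ f ] (Computable {1} f × (∀ n → n ∈ A ⇔ (∃[ m ] f (m ∷ []) ≡ n)))

String : Set
String = List Bool

-- The bijection {0,1}* → ℕ given by bijective base-2 numeration.
⌜_⌝ : String → ℕ
⌜ [] ⌝    = 0
⌜ b ∷ w ⌝ = (if b then 2 else 1) ℕ.+ 2 ℕ.* ⌜ w ⌝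

-- Rational values are presented as (a - b) / (c + 1).
Computableℚ : (String → ℕ → ℚ) → Set
Computableℚ f = ∃[ a ] ∃[ b ] ∃[ c ]
  (Computable {2} a × Computable {2} b × Computable {2} c ×
   (∀ w t → let xs = ⌜ w ⌝ ∷ t ∷ [] in f w t ≡ (a xs ℤ.⊖ b xs) ℚ./ suc (c xs)))

record LowerSemicomputable (f : String → ℝ) : Set₁ where
  field
    approx     : String → ℕ → ℚ
    computable : Computableℚ approx
    monotone   : ∀ w t → approx w t ℚ.≤ approx w (suc t)
    below      : ∀ w t → fromℚ (approx w t) < f w
    converges  : ∀ w → Converges (approx w) (f w)

Cantor : Set
Cantor = ℕ → Bool

-- S [0‥ n -1] = S[0] S[1] … S[n-1]
_[0‥_-1] : Cantor → ℕ → String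
S [0‥ n -1] = applyUpTo S n

record IsSupergale (s : ℝ) (d : String → ℝ) : Set where
  field
    nonNegative : ∀ w → 0ℝ ≤ d w
    average     : ∀ w → 2^ (- s) * (d (w ∷ʳ false) + d (w ∷ʳ true)) ≤ d w

S^∞[_] : (String → ℝ) → Cantor → Set₁
S^∞[ d ] S = LimsupInfinite (λ n → d (S [0‥ n -1]))

CdimAdmissible : Pred Cantor 0ℓ → ℝ → Set₁
CdimAdmissible X s =
  0ℝ ≤ s ×
  ∃[ d ] (IsSupergale s d × LowerSemicomputable d × (∀ S → S ∈ X → S ∈ S^∞[ d ]))

-- cdim(X) = r. An infimum is unique, so this relation is the graph of cdim
-- (on those X with finite cdim).
cdim_≐_ : Pred Cantor 0ℓ → ℝ → Set₁
cdim X ≐ r = IsInfimum (CdimAdmissible X) r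

-- The members of {S} are the sequences with the same bits as S.
dim_≐_ : Cantor → ℝ → Set₁
dim S ≐ r = cdim (S ≗_) ≐ r

Σ⁰₁ Π⁰₁ : Cantor → Set
Σ⁰₁ S = ComputablyEnumerable (λ n → S n ≡ true)
Π⁰₁ S = ComputablyEnumerable (λ n → S n ≡ false)

{-# OPTIONS --safe #-}

-- Let g enumerate the n with S n = v, and let A(i) be the approximation to S
-- after i stages. Whenever stage i enumerates a new number g(i), a gambler with
-- initial capital γ^g(i) starts betting everything on S = A(i + 1), at payoff
-- rate r ≤ 2^s per bit. The initial capitals sum to at most 1 / (1 - γ), because
-- each number is new only once, so the total capital d is finite and lower
-- semicomputable, and it is an s-supergale. For large n, the last stage i that
-- enumerates a new number below n yields the first n bits of S, so d reaches
-- r^n γ^g(i) ≥ (r γ)^n on them. Choosing r = γ⁻² with γ < 1 close enough to 1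
-- makes this unbounded, for every s = 1 / k.

module Submission where

import Algebra.Bundles
import Algebra.Properties.CommutativeSemiring.Exp
import Algebra.Properties.Semiring.Exp
open import Data.Bool.Base using (Bool; true; false; not; if_then_else_)
import Data.Bool.Properties as Boolₚ
open import Data.Fin.Base as Fin using (Fin)
open import Data.Fin.Patterns using (0F; 1F; 2F)
open import Data.Integer.Base as ℤ using (+_; -[1+_])
import Data.Integer.Properties as ℤₚ
open import Data.List.Base using ([]; _∷_; _∷ʳ_; applyUpTo; length)
open import Data.List.Properties using (applyUpTo-∷ʳ; length-applyUpTo; ∷-injectiveˡ; ∷-injectiveʳ)
open import Data.Nat.Base as ℕ using (ℕ; zero; suc; _∸_)
import Data.Nat.Properties as ℕₚ
import Data.Nat.Solver
open import Data.Product.Base using (∃-syntax; Σ-syntax; _×_; _,_; proj₁; proj₂)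
open import Data.Rational.Base as ℚ using (ℚ; 0ℚ; 1ℚ; ½; ↥_; ↧_)
import Data.Rational.Properties as ℚₚ
open import Data.Rational.Solver using (module +-*-Solver)
import Data.Rational.Unnormalised.Base as ℚᵘ
import Data.Rational.Unnormalised.Properties as ℚᵘₚ
open import Data.Sum.Base using (_⊎_; inj₁; inj₂)
open import Data.Vec.Base as Vec using (Vec; []; _∷_; lookup; head; tail)
open import Data.Vec.Properties using (tabulate-∘; tabulate∘lookup)
open import Data.Vec.Relation.Binary.Pointwise.Inductive using (Pointwise; []; _∷_)
open import Data.Vec.Relation.Unary.All using (All; []; _∷_)
open import Data.Vec.Relation.Unary.All.Properties using (tabulate⁺)
open import Function.Base using (_∘_)
open import Function.Bundles using (_⇔_; mk⇔; Equivalence)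
open import Relation.Binary.PropositionalEquality
open import Relation.Nullary using (yes; no; does; contradiction)
open import Relation.Unary using (_∈_)
open import Defs

open Algebra.Bundles.CommutativeRing ℚₚ.+-*-commutativeRing
  using () renaming (semiring to ℚ-semiring; commutativeSemiring to ℚ-commutativeSemiring)
open Algebra.Properties.Semiring.Exp ℚ-semiring using (^-homo-*)
open Algebra.Properties.CommutativeSemiring.Exp ℚ-commutativeSemiring using (^-distrib-*)

-- Computable functions

proj : ∀ {n} (i : Fin n) → Computable (λ xs → lookup xs i)
proj i = projᶜ i , λ _ → ⇓proj

compose : ∀ {n k} {f : Vec ℕ k → ℕ} {gs : Vec (Vec ℕ n → ℕ) k} →
          Computable f → All Computable gs → Computable (λ xs → f (Vec.map (λ g → g xs) gs))
compose {n} {f = f} {gs} (e , e⇓) cgs =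
  let (es , es⇓) = codes cgs in compᶜ e es , λ xs → ⇓comp (es⇓ xs) (e⇓ _)
  where
  codes : ∀ {k} {gs : Vec (Vec ℕ n → ℕ) k} → All Computable gs →
          Σ[ es ∈ Vec (Code n) k ] (∀ xs → Pointwise (λ e y → e [ xs ]⇓ y) es (Vec.map (λ g → g xs) gs))
  codes []                = [] , λ _ → []
  codes ((e , e⇓) ∷ cgs) = let (es , es⇓) = codes cgs in e ∷ es , λ xs → e⇓ xs ∷ es⇓ xs

primrec : ∀ {n} {h : Vec ℕ (suc n) → ℕ} {f : Vec ℕ n → ℕ} {g : Vec ℕ (suc (suc n)) → ℕ} →
          Computable f → Computable g →
          (∀ xs → h (0 ∷ xs) ≡ f xs) → (∀ m xs → h (suc m ∷ xs) ≡ g (m ∷ h (m ∷ xs) ∷ xs)) →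
          Computable h
primrec {h = h} {f} {g} (e , e⇓) (e′ , e′⇓) h0 hs =
  precᶜ e e′ , λ { (m ∷ xs) → eval m xs }
  where
  eval : ∀ m xs → precᶜ e e′ [ m ∷ xs ]⇓ h (m ∷ xs)
  eval zero    xs = subst (precᶜ e e′ [ 0 ∷ xs ]⇓_) (sym (h0 xs)) (⇓prec₀ (e⇓ xs))
  eval (suc m) xs = subst (precᶜ e e′ [ suc m ∷ xs ]⇓_) (sym (hs m xs))
                      (⇓precₛ (eval m xs) (e′⇓ _))

Computable₂ : (ℕ → ℕ → ℕ) → Set
Computable₂ f = Computable {2} (λ xs → f (lookup xs 0F) (lookup xs 1F))

module _ {n} {a : Vec ℕ n → ℕ} where
  apply₁ : (f : ℕ → ℕ) → Computable {1} (λ xs → f (lookup xs 0F)) → Computable a →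
           Computable (λ xs → f (a xs))
  apply₁ f cf ca = compose cf (ca ∷ [])

  suc-computable : Computable a → Computable (λ xs → suc (a xs))
  suc-computable = apply₁ suc (sucᶜ , λ { (_ ∷ []) → ⇓suc })

module _ {n} {a b : Vec ℕ n → ℕ} where
  apply₂ : (f : ℕ → ℕ → ℕ) → Computable₂ f → Computable a → Computable b →
           Computable (λ xs → f (a xs) (b xs))
  apply₂ f cf ca cb = compose cf (ca ∷ cb ∷ [])

const : ∀ {n} k → Computable {n} (λ _ → k)
const zero    = zeroᶜ , λ _ → ⇓zero
const (suc k) = suc-computable (const k)

+-computable : Computable₂ ℕ._+_
+-computable = primrec (proj 0F) (suc-computable (proj 1F)) (λ _ → refl) (λ _ _ → refl)

*-computable : Computable₂ ℕ._*_
*-computable = primrec (const 0) (apply₂ ℕ._+_ +-computable (proj 2F) (proj 1F))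
                 (λ _ → refl) (λ _ _ → refl)

∸-computable : Computable₂ _∸_
∸-computable = apply₂ (λ y x → x ∸ y) flipped (proj 1F) (proj 0F)
  where
  pred-computable : Computable {1} (λ xs → ℕ.pred (lookup xs 0F))
  pred-computable = primrec (const 0) (proj 0F) (λ _ → refl) (λ _ _ → refl)

  flipped : Computable₂ (λ y x → x ∸ y)
  flipped = primrec (proj 0F) (apply₁ ℕ.pred pred-computable (proj 1F)) (λ _ → refl)
              (λ m xs → sym (ℕₚ.pred[m∸n]≡m∸[1+n] (lookup xs 0F) m))

module _ {n} {a b : Vec ℕ n → ℕ} (ca : Computable a) (cb : Computable b) where
  infixl 6 _⊕_ _⊝_
  infixl 7 _⊛_

  _⊕_ : Computable (λ xs → a xs ℕ.+ b xs)
  _⊕_ = apply₂ ℕ._+_ +-computable ca cb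

  _⊛_ : Computable (λ xs → a xs ℕ.* b xs)
  _⊛_ = apply₂ ℕ._*_ *-computable ca cb

  _⊝_ : Computable (λ xs → a xs ∸ b xs)
  _⊝_ = apply₂ _∸_ ∸-computable ca cb

-- Rational-valued computable functions

∑ℕ : ℕ → (ℕ → ℕ) → ℕ
∑ℕ zero    f = 0
∑ℕ (suc m) f = ∑ℕ m f ℕ.+ f m

∑ : ℕ → (ℕ → ℚ) → ℚ
∑ zero    f = 0ℚ
∑ (suc m) f = ∑ m f ℚ.+ f m

infix 8 _/1+_

opaque
  -- The denominator is shifted by one, so that every pair of naturals denotes a fraction.
  _/1+_ : ℕ → ℕ → ℚ
  a /1+ c = + a ℚ./ suc c

  toℚᵘ-/ : ∀ a c → ℚ.toℚᵘ (a /1+ c) ℚᵘ.≃ ℚᵘ.mkℚᵘ (+ a) c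
  toℚᵘ-/ a c = ℚₚ.toℚᵘ-fromℚᵘ (ℚᵘ.mkℚᵘ (+ a) c)

  /-≡ : ∀ {a c b e} → a ℕ.* suc e ≡ b ℕ.* suc c → a /1+ c ≡ b /1+ e
  /-≡ {a} {c} {b} {e} eq = ℚₚ.fromℚᵘ-cong {ℚᵘ.mkℚᵘ (+ a) c} {ℚᵘ.mkℚᵘ (+ b) e}
    (ℚᵘ.*≡* (trans (sym (ℤₚ.pos-* a (suc e))) (trans (cong +_ eq) (ℤₚ.pos-* b (suc c)))))

  0≡0/ : 0ℚ ≡ 0 /1+ 0
  0≡0/ = refl

  1≡1/ : 1ℚ ≡ 1 /1+ 0
  1≡1/ = refl

-- Denominators are stored minus one: `e ℕ.+ c ℕ.* suc e` is the predecessor of `suc c ℕ.* suc e`.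
/-+ : ∀ a c b e → a /1+ c ℚ.+ b /1+ e ≡ (a ℕ.* suc e ℕ.+ b ℕ.* suc c) /1+ (e ℕ.+ c ℕ.* suc e)
/-+ a c b e = ℚₚ.toℚᵘ-injective (begin
  ℚ.toℚᵘ (a /1+ c ℚ.+ b /1+ e)                ≈⟨ ℚₚ.toℚᵘ-homo-+ (a /1+ c) (b /1+ e) ⟩
  ℚ.toℚᵘ (a /1+ c) ℚᵘ.+ ℚ.toℚᵘ (b /1+ e)      ≈⟨ ℚᵘₚ.+-cong (toℚᵘ-/ a c) (toℚᵘ-/ b e) ⟩
  ℚᵘ.mkℚᵘ (+ a) c ℚᵘ.+ ℚᵘ.mkℚᵘ (+ b) e        ≡⟨ cong (λ z → ℚᵘ.mkℚᵘ z (e ℕ.+ c ℕ.* suc e)) num ⟩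
  ℚᵘ.mkℚᵘ (+ (a ℕ.* suc e ℕ.+ b ℕ.* suc c)) (e ℕ.+ c ℕ.* suc e) ≈⟨ toℚᵘ-/ _ _ ⟨
  ℚ.toℚᵘ ((a ℕ.* suc e ℕ.+ b ℕ.* suc c) /1+ (e ℕ.+ c ℕ.* suc e)) ∎)
  where
  open ℚᵘₚ.≃-Reasoning
  num : + a ℤ.* + suc e ℤ.+ + b ℤ.* + suc c ≡ + (a ℕ.* suc e ℕ.+ b ℕ.* suc c)
  num = trans (cong₂ ℤ._+_ (sym (ℤₚ.pos-* a (suc e))) (sym (ℤₚ.pos-* b (suc c))))
          (sym (ℤₚ.pos-+ (a ℕ.* suc e) (b ℕ.* suc c)))

/-* : ∀ a c b e → a /1+ c ℚ.* b /1+ e ≡ (a ℕ.* b) /1+ (e ℕ.+ c ℕ.* suc e)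
/-* a c b e = ℚₚ.toℚᵘ-injective (begin
  ℚ.toℚᵘ (a /1+ c ℚ.* b /1+ e)                ≈⟨ ℚₚ.toℚᵘ-homo-* (a /1+ c) (b /1+ e) ⟩
  ℚ.toℚᵘ (a /1+ c) ℚᵘ.* ℚ.toℚᵘ (b /1+ e)      ≈⟨ ℚᵘₚ.*-cong (toℚᵘ-/ a c) (toℚᵘ-/ b e) ⟩
  ℚᵘ.mkℚᵘ (+ a) c ℚᵘ.* ℚᵘ.mkℚᵘ (+ b) e
    ≡⟨ cong (λ z → ℚᵘ.mkℚᵘ z (e ℕ.+ c ℕ.* suc e)) (sym (ℤₚ.pos-* a b)) ⟩
  ℚᵘ.mkℚᵘ (+ (a ℕ.* b)) (e ℕ.+ c ℕ.* suc e)   ≈⟨ toℚᵘ-/ _ _ ⟨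
  ℚ.toℚᵘ ((a ℕ.* b) /1+ (e ℕ.+ c ℕ.* suc e)) ∎)
  where
  open ℚᵘₚ.≃-Reasoning

-- Numerator and denominator need not be coprime, so sums and products are formed without any gcd.
-- Nonnegative values suffice, as the approximations to the supergale are nonnegative.
record Computable⁺ {n} (q : Vec ℕ n → ℚ) : Set where
  field
    {num den} : Vec ℕ n → ℕ
    num-computable : Computable num
    den-computable : Computable den
    fraction       : ∀ xs → q xs ≡ num xs /1+ den xs

open Computable⁺

frac : ∀ {n} {a : Vec ℕ n → ℕ} → Computable a → ∀ c → Computable⁺ (λ xs → a xs /1+ c)
frac ca c = record { num-computable = ca ; den-computable = const c ; fraction = λ _ → refl }

compose⁺ : ∀ {n k} {q : Vec ℕ k → ℚ} {gs : Vec (Vec ℕ n → ℕ) k} →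
           Computable⁺ q → All Computable gs → Computable⁺ (λ xs → q (Vec.map (λ g → g xs) gs))
compose⁺ cq cgs = record
  { num-computable = compose (num-computable cq) cgs
  ; den-computable = compose (den-computable cq) cgs
  ; fraction       = λ _ → fraction cq _
  }

module _ {n} {p q : Vec ℕ n → ℚ} (cp : Computable⁺ p) (cq : Computable⁺ q) where
  infixl 6 _⊕⁺_
  infixl 7 _⊛⁺_

  _⊕⁺_ : Computable⁺ (λ xs → p xs ℚ.+ q xs)
  _⊕⁺_ = record
    { num-computable = num-computable cp ⊛ suc-computable (den-computable cq)
                       ⊕ num-computable cq ⊛ suc-computable (den-computable cp)
    ; den-computable = den-computable cq ⊕ den-computable cp ⊛ suc-computable (den-computable cq)
    ; fraction       = λ xs → trans (cong₂ ℚ._+_ (fraction cp xs) (fraction cq xs))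
                              (/-+ (num cp xs) (den cp xs) (num cq xs) (den cq xs))
    }

  _⊛⁺_ : Computable⁺ (λ xs → p xs ℚ.* q xs)
  _⊛⁺_ = record
    { num-computable = num-computable cp ⊛ num-computable cq
    ; den-computable = den-computable cq ⊕ den-computable cp ⊛ suc-computable (den-computable cq)
    ; fraction       = λ xs → trans (cong₂ ℚ._*_ (fraction cp xs) (fraction cq xs))
                              (/-* (num cp xs) (den cp xs) (num cq xs) (den cq xs))
    }

power⁺ : ∀ {n} {e : Vec ℕ n → ℕ} a c → Computable e → Computable⁺ (λ xs → (a /1+ c) ^ℚ e xs)
power⁺ a c ce = compose⁺ {q = λ xs → (a /1+ c) ^ℚ lookup xs 0F} record
  { num-computable = primrec {h = λ xs → N (lookup xs 0F)} (const 1) (const a ⊛ proj 1F)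
                       (λ _ → refl) (λ _ _ → refl)
  ; den-computable = primrec {h = λ xs → D (lookup xs 0F)} (const 0)
                       (proj 1F ⊕ const c ⊛ suc-computable (proj 1F))
                       (λ _ → refl) (λ _ _ → refl)
  ; fraction       = λ { (m ∷ []) → eq m }
  } (ce ∷ [])
  where
  N D : ℕ → ℕ
  N zero    = 1
  N (suc m) = a ℕ.* N m
  -- `suc (D m)` is the `m`-th power of `suc c`.
  D zero    = 0
  D (suc m) = D m ℕ.+ c ℕ.* suc (D m)

  eq : ∀ m → (a /1+ c) ^ℚ m ≡ N m /1+ D m
  eq zero    = 1≡1/
  eq (suc m) = trans (cong (a /1+ c ℚ.*_) (eq m)) (/-* a c (N m) (D m))

-- The step function of `primrec` also receives the previous value; functions of the counter and the
-- parameters alone are adapted to it in this way.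
skip-second : ∀ {n} {f : Vec ℕ (suc n) → ℕ} → Computable f →
              Computable {suc (suc n)} (λ ys → f (head ys ∷ tail (tail ys)))
skip-second {f = f} cf =
  let (e , e⇓) = compose {gs = _ ∷ Vec.tabulate (λ i ys → lookup ys (Fin.suc (Fin.suc i)))} cf
                   (proj 0F ∷ tabulate⁺ (λ i → proj (Fin.suc (Fin.suc i))))
  in e , λ { (m ∷ y ∷ xs) → subst (λ zs → e [ m ∷ y ∷ xs ]⇓ f (m ∷ zs))
       (trans (sym (tabulate-∘ _ (λ i ys → lookup ys (Fin.suc (Fin.suc i))))) (tabulate∘lookup xs))
       (e⇓ (m ∷ y ∷ xs)) }

-- `suc (D m xs)` is the product of the first `m` denominators. The recursion for `N` calls `D`,
-- whose computability is therefore shown separately.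
sum⁺ : ∀ {n} {q : Vec ℕ (suc n) → ℚ} → Computable⁺ q →
       Computable⁺ {suc n} (λ ys → ∑ (head ys) (λ i → q (i ∷ tail ys)))
sum⁺ {n} {q} cq = record
  { num-computable = primrec {h = λ ys → N (head ys) (tail ys)} (const 0)
                       (proj 1F ⊛ suc-computable (skip-second (den-computable cq))
                        ⊕ skip-second (num-computable cq) ⊛ suc-computable (skip-second D-computable))
                       (λ _ → refl) (λ _ _ → refl)
  ; den-computable = D-computable
  ; fraction       = λ { (m ∷ xs) → eq m xs }
  }
  where
  N D : ℕ → Vec ℕ n → ℕ
  D zero    xs = 0
  D (suc m) xs = den cq (m ∷ xs) ℕ.+ D m xs ℕ.* suc (den cq (m ∷ xs))
  N zero    xs = 0
  N (suc m) xs = N m xs ℕ.* suc (den cq (m ∷ xs)) ℕ.+ num cq (m ∷ xs) ℕ.* suc (D m xs)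

  D-computable : Computable {suc n} (λ ys → D (head ys) (tail ys))
  D-computable = primrec (const 0)
                   (skip-second (den-computable cq)
                    ⊕ proj 1F ⊛ suc-computable (skip-second (den-computable cq)))
                   (λ _ → refl) (λ _ _ → refl)

  eq : ∀ m xs → ∑ m (λ i → q (i ∷ xs)) ≡ N m xs /1+ D m xs
  eq zero    xs = 0≡0/
  eq (suc m) xs = trans (cong₂ ℚ._+_ (eq m xs) (fraction cq (m ∷ xs)))
                    (/-+ (N m xs) (D m xs) (num cq (m ∷ xs)) (den cq (m ∷ xs)))

-- Rational inequalities and sums

opaque
  unfolding _/1+_

  0≤/ : ∀ a c → 0ℚ ℚ.≤ a /1+ c
  0≤/ a c = ℚₚ.nonNegative⁻¹ (a /1+ c) {{ℚₚ.normalize-nonNeg a (suc c)}}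

  0</ : ∀ a c → 0ℚ ℚ.< suc a /1+ c
  0</ a c = ℚₚ.positive⁻¹ (suc a /1+ c) {{ℚₚ.normalize-pos (suc a) (suc c)}}

  1/2≡½ : 1 /1+ 1 ≡ ½
  1/2≡½ = refl

  -1/ : ∀ c → ℚ.toℚᵘ (ℚ.- (1 /1+ c)) ℚᵘ.≃ ℚᵘ.mkℚᵘ -[1+ 0 ] c
  -1/ c = ℚₚ.toℚᵘ-fromℚᵘ (ℚᵘ.mkℚᵘ -[1+ 0 ] c)

  ≤↥ : ∀ q → q ℚ.≤ ℤ.∣ ↥ q ∣ /1+ 0
  ≤↥ q@(ℚ.mkℚ a d _) =
    ℚₚ.toℚᵘ-cancel-≤ (ℚᵘₚ.≤-respʳ-≃ (ℚᵘₚ.≃-sym (toℚᵘ-/ ℤ.∣ a ∣ 0)) (ℚᵘ.*≤* (go a d)))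
    where
    go : ∀ a d → a ℤ.* + 1 ℤ.≤ + ℤ.∣ a ∣ ℤ.* + suc d
    go (+ n) d = subst₂ ℤ._≤_ (sym (ℤₚ.*-identityʳ (+ n))) (ℤₚ.pos-* n (suc d))
                   (ℤ.+≤+ (ℕₚ.m≤m*n n (suc d)))
    go -[1+ n ] d = subst (-[1+ n ] ℤ.* + 1 ℤ.≤_) (ℤₚ.pos-* (suc n) (suc d)) ℤ.-≤+

  -- A positive fraction has numerator at least 1, so its own denominator serves.
  1/1+≤ : ∀ {q} → 0ℚ ℚ.< q → ∃[ k ] 1 /1+ k ℚ.≤ q
  1/1+≤ {ℚ.mkℚ (+ suc n) d c} 0<q = d , ℚₚ.toℚᵘ-cancel-≤ (ℚᵘₚ.≤-respˡ-≃ (ℚᵘₚ.≃-sym (toℚᵘ-/ 1 d))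
    (ℚᵘ.*≤* (ℤₚ.*-monoʳ-≤-nonNeg (+ suc d) (ℤ.+≤+ (ℕ.s≤s (ℕ.z≤n {n}))))))
  1/1+≤ {ℚ.mkℚ (+ 0) d c}      0<q = contradiction (ℚ.positive 0<q) λ ()
  1/1+≤ {ℚ.mkℚ -[1+ n ] d c}   0<q = contradiction (ℚ.positive 0<q) λ ()

/-nonNeg : ∀ a c → ℚ.NonNegative (a /1+ c)
/-nonNeg a c = ℚ.nonNegative (0≤/ a c)

0≤1 : 0ℚ ℚ.≤ 1ℚ
0≤1 = ℚₚ.nonNegative⁻¹ 1ℚ

0≤½ : 0ℚ ℚ.≤ ½
0≤½ = ℚₚ.nonNegative⁻¹ ½

+-nonNeg : ∀ {p q} → 0ℚ ℚ.≤ p → 0ℚ ℚ.≤ q → 0ℚ ℚ.≤ p ℚ.+ q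
+-nonNeg = ℚₚ.+-mono-≤

*-nonNeg : ∀ {p q} → 0ℚ ℚ.≤ p → 0ℚ ℚ.≤ q → 0ℚ ℚ.≤ p ℚ.* q
*-nonNeg {p} {q} 0≤p 0≤q = subst (ℚ._≤ p ℚ.* q) (ℚₚ.*-zeroˡ 0ℚ) (*-mono {0ℚ} ℚₚ.≤-refl 0≤q 0≤p 0≤q)

p≤p+q : ∀ p {q} → 0ℚ ℚ.≤ q → p ℚ.≤ p ℚ.+ q
p≤p+q p {q} 0≤q = subst (ℚ._≤ p ℚ.+ q) (ℚₚ.+-identityʳ p) (ℚₚ.+-monoʳ-≤ p 0≤q)

p<p+q : ∀ p {q} → 0ℚ ℚ.< q → p ℚ.< p ℚ.+ q
p<p+q p {q} 0<q = subst (ℚ._< p ℚ.+ q) (ℚₚ.+-identityʳ p) (ℚₚ.+-monoʳ-< p 0<q)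

^-pos : ∀ {p} → 0ℚ ℚ.< p → ∀ n → 0ℚ ℚ.< p ^ℚ n
^-pos 0<p zero = ℚₚ.positive⁻¹ 1ℚ
^-pos {p} 0<p (suc n) = ℚₚ.positive⁻¹ (p ℚ.* p ^ℚ n)
  {{ℚₚ.pos*pos⇒pos p {{ℚ.positive 0<p}} (p ^ℚ n) {{ℚ.positive (^-pos 0<p n)}}}}

^-monoˡ-≤ : ∀ {p q} → 0ℚ ℚ.≤ p → p ℚ.≤ q → ∀ n → p ^ℚ n ℚ.≤ q ^ℚ n
^-monoˡ-≤ 0≤p p≤q zero    = ℚₚ.≤-refl
^-monoˡ-≤ 0≤p p≤q (suc n) = *-mono 0≤p (^-nonNeg (ℚₚ.≤-trans 0≤p p≤q) n) p≤q (^-monoˡ-≤ 0≤p p≤q n)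

^≤1 : ∀ {p} → 0ℚ ℚ.≤ p → p ℚ.≤ 1ℚ → ∀ n → p ^ℚ n ℚ.≤ 1ℚ
^≤1 0≤p p≤1 zero    = ℚₚ.≤-refl
^≤1 0≤p p≤1 (suc n) = *-mono {q = 1ℚ} {s = 1ℚ} 0≤p 0≤1 p≤1 (^≤1 0≤p p≤1 n)

^-antimonoʳ-≤ : ∀ {p m n} → 0ℚ ℚ.≤ p → p ℚ.≤ 1ℚ → m ℕ.≤ n → p ^ℚ n ℚ.≤ p ^ℚ m
^-antimonoʳ-≤ {n = n} 0≤p p≤1 ℕ.z≤n = ^≤1 0≤p p≤1 n
^-antimonoʳ-≤ {m = suc m} 0≤p p≤1 (ℕ.s≤s m≤n) =
  *-mono 0≤p (^-nonNeg 0≤p m) ℚₚ.≤-refl (^-antimonoʳ-≤ 0≤p p≤1 m≤n)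

∑-cong : ∀ {f g} → (∀ i → f i ≡ g i) → ∀ m → ∑ m f ≡ ∑ m g
∑-cong eq zero    = refl
∑-cong eq (suc m) = cong₂ ℚ._+_ (∑-cong eq m) (eq m)

∑-mono-≤ : ∀ {f g} → (∀ i → f i ℚ.≤ g i) → ∀ m → ∑ m f ℚ.≤ ∑ m g
∑-mono-≤ le zero    = ℚₚ.≤-refl
∑-mono-≤ le (suc m) = ℚₚ.+-mono-≤ (∑-mono-≤ le m) (le m)

∑-zero : ∀ {f} m → (∀ i → i ℕ.< m → f i ≡ 0ℚ) → ∑ m f ≡ 0ℚ
∑-zero zero    eq = refl
∑-zero (suc m) eq = cong₂ ℚ._+_ (∑-zero m (λ i i<m → eq i (ℕₚ.m<n⇒m<1+n i<m))) (eq m ℕₚ.≤-refl)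

∑-nonNeg : ∀ {f} → (∀ i → 0ℚ ℚ.≤ f i) → ∀ m → 0ℚ ℚ.≤ ∑ m f
∑-nonNeg 0≤f zero    = ℚₚ.≤-refl
∑-nonNeg 0≤f (suc m) = +-nonNeg (∑-nonNeg 0≤f m) (0≤f m)

∑-distrib-+ : ∀ f g m → ∑ m (λ i → f i ℚ.+ g i) ≡ ∑ m f ℚ.+ ∑ m g
∑-distrib-+ f g zero    = refl
∑-distrib-+ f g (suc m) = trans (cong (ℚ._+ (f m ℚ.+ g m)) (∑-distrib-+ f g m))
  (solve 4 (λ a b c d → (a :+ b) :+ (c :+ d) := (a :+ c) :+ (b :+ d)) refl (∑ m f) (∑ m g) (f m) (g m))
  where
  open +-*-Solver

*-distribˡ-∑ : ∀ c f m → c ℚ.* ∑ m f ≡ ∑ m (λ i → c ℚ.* f i)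
*-distribˡ-∑ c f zero    = ℚₚ.*-zeroʳ c
*-distribˡ-∑ c f (suc m) =
  trans (ℚₚ.*-distribˡ-+ c (∑ m f) (f m)) (cong (ℚ._+ c ℚ.* f m) (*-distribˡ-∑ c f m))

∑-single : ∀ {f j m} → (∀ i → i ≢ j → f i ≡ 0ℚ) → j ℕ.< m → ∑ m f ≡ f j
∑-single {f} {j} {suc m} others j<1+m with j ℕₚ.≟ m
... | yes refl = trans (cong (ℚ._+ f m) (∑-zero m (λ i i<m → others i (ℕₚ.<⇒≢ i<m))))
                   (ℚₚ.+-identityˡ (f m))
... | no  j≢m  = trans (cong₂ ℚ._+_ (∑-single others (ℕₚ.≤∧≢⇒< (ℕₚ.≤-pred j<1+m) j≢m))
                                   (others m (λ m≡j → j≢m (sym m≡j))))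
                   (ℚₚ.+-identityʳ (f j))

term≤∑ : ∀ {f} → (∀ i → 0ℚ ℚ.≤ f i) → ∀ {j m} → j ℕ.< m → f j ℚ.≤ ∑ m f
term≤∑ {f} 0≤f {j} {suc m} j<1+m with j ℕₚ.≟ m
... | yes refl = subst (ℚ._≤ ∑ m f ℚ.+ f m) (ℚₚ.+-identityˡ (f m)) (ℚₚ.+-monoˡ-≤ (f m) (∑-nonNeg 0≤f m))
... | no  j≢m  = ℚₚ.≤-trans (term≤∑ 0≤f (ℕₚ.≤∧≢⇒< (ℕₚ.≤-pred j<1+m) j≢m)) (p≤p+q (∑ m f) (0≤f m))

∑-mono-bound : ∀ {f} → (∀ i → 0ℚ ℚ.≤ f i) → ∀ {m n} → m ℕ.≤ n → ∑ m f ℚ.≤ ∑ n f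
∑-mono-bound 0≤f {m} {zero} ℕ.z≤n = ℚₚ.≤-refl
∑-mono-bound {f} 0≤f {m} {suc n} m≤1+n with m ℕₚ.≟ suc n
... | yes refl = ℚₚ.≤-refl
... | no  m≢   = ℚₚ.≤-trans (∑-mono-bound 0≤f (ℕₚ.≤-pred (ℕₚ.≤∧≢⇒< m≤1+n m≢))) (p≤p+q (∑ n f) (0≤f n))

1+/ : ∀ n → suc n /1+ 0 ≡ n /1+ 0 ℚ.+ 1ℚ
1+/ n = sym (trans (cong (n /1+ 0 ℚ.+_) 1≡1/) (trans (/-+ n 0 1 0) (/-≡ {c = 0} {e = 0}
  (solve 1 (λ n → (n :* con 1 :+ con 1 :* con 1) :* con 1 := (con 1 :+ n) :* con 1) refl n))))
  where
  open Data.Nat.Solver.+-*-Solver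

-- The powers of γ = N / (N + 1) and of β = 1 / γ, where N = ℓ + 1.
module Base (ℓ : ℕ) where
  ν μ γ β ρ r : ℚ
  ν = suc ℓ /1+ 0
  μ = suc (suc ℓ) /1+ 0
  γ = suc ℓ /1+ suc ℓ
  β = suc (suc ℓ) /1+ ℓ
  ρ = γ ℚ.* γ
  r = β ℚ.* β

  γβ≡1 : γ ℚ.* β ≡ 1ℚ
  γβ≡1 = trans (/-* (suc ℓ) (suc ℓ) (suc (suc ℓ)) ℓ) (trans
    (/-≡ {e = 0} (trans (ℕₚ.*-identityʳ _)
      (trans (ℕₚ.*-comm (suc ℓ) (suc (suc ℓ))) (sym (ℕₚ.+-identityʳ _)))))
    (sym 1≡1/))

  μγ≡ν : μ ℚ.* γ ≡ ν
  μγ≡ν = trans (/-* (suc (suc ℓ)) 0 (suc ℓ) (suc ℓ))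
    (/-≡ {b = suc ℓ} {e = 0}
      (solve 1 (λ l → (con 2 :+ l) :* (con 1 :+ l) :* con 1
                      := (con 1 :+ l) :* (con 1 :+ (con 1 :+ l :+ con 0))) refl ℓ))
    where
    open Data.Nat.Solver.+-*-Solver

  νβ≡μ : ν ℚ.* β ≡ μ
  νβ≡μ = begin
    ν ℚ.* β            ≡⟨ cong (ℚ._* β) (sym μγ≡ν) ⟩
    μ ℚ.* γ ℚ.* β      ≡⟨ ℚₚ.*-assoc μ γ β ⟩
    μ ℚ.* (γ ℚ.* β)    ≡⟨ cong (μ ℚ.*_) γβ≡1 ⟩
    μ ℚ.* 1ℚ           ≡⟨ ℚₚ.*-identityʳ μ ⟩
    μ                  ∎
    where
    open ≡-Reasoning

  0<γ : 0ℚ ℚ.< γ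
  0<γ = 0</ ℓ (suc ℓ)

  0≤γ : 0ℚ ℚ.≤ γ
  0≤γ = 0≤/ (suc ℓ) (suc ℓ)

  0≤β : 0ℚ ℚ.≤ β
  0≤β = 0≤/ (suc (suc ℓ)) ℓ

  0≤ρ : 0ℚ ℚ.≤ ρ
  0≤ρ = *-nonNeg 0≤γ 0≤γ

  0≤r : 0ℚ ℚ.≤ r
  0≤r = *-nonNeg 0≤β 0≤β

  ρr≡1 : ρ ℚ.* r ≡ 1ℚ
  ρr≡1 = trans (solve 2 (λ g b → (g :* g) :* (b :* b) := (g :* b) :* (g :* b)) refl γ β)
           (cong₂ ℚ._*_ γβ≡1 γβ≡1)
    where
    open +-*-Solver

  γ≤1 : γ ℚ.≤ 1ℚ
  γ≤1 = ℚₚ.*-cancelˡ-≤-pos μ {{ℚ.positive (0</ (suc ℓ) 0)}}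
    (subst₂ ℚ._≤_ (sym μγ≡ν) (sym (trans (ℚₚ.*-identityʳ μ) (1+/ (suc ℓ)))) (p≤p+q ν 0≤1))

  1≤β : 1ℚ ℚ.≤ β
  1≤β = subst₂ ℚ._≤_ γβ≡1 (ℚₚ.*-identityˡ β) (*-mono {q = 1ℚ} 0≤γ 0≤β γ≤1 ℚₚ.≤-refl)

  -- The geometric series in closed form, as `μ` is 1 / (1 - γ); the induction uses μγ + 1 = μ.
  ∑γ : ∀ n → ∑ n (γ ^ℚ_) ℚ.+ μ ℚ.* γ ^ℚ n ≡ μ
  ∑γ zero    = trans (ℚₚ.+-identityˡ _) (ℚₚ.*-identityʳ μ)
  ∑γ (suc n) = begin
    ∑ n (γ ^ℚ_) ℚ.+ γ ^ℚ n ℚ.+ μ ℚ.* (γ ℚ.* γ ^ℚ n)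
      ≡⟨ solve 4 (λ s x m g → s :+ x :+ m :* (g :* x) := s :+ (m :* g :+ con 1ℚ) :* x) refl
           (∑ n (γ ^ℚ_)) (γ ^ℚ n) μ γ ⟩
    ∑ n (γ ^ℚ_) ℚ.+ (μ ℚ.* γ ℚ.+ 1ℚ) ℚ.* γ ^ℚ n
      ≡⟨ cong (λ z → ∑ n (γ ^ℚ_) ℚ.+ z ℚ.* γ ^ℚ n)
           (trans (cong (ℚ._+ 1ℚ) μγ≡ν) (sym (1+/ (suc ℓ)))) ⟩
    ∑ n (γ ^ℚ_) ℚ.+ μ ℚ.* γ ^ℚ n
      ≡⟨ ∑γ n ⟩
    μ ∎
    where
    open ≡-Reasoning
    open +-*-Solver

  ∑γ≤μ : ∀ n → ∑ n (γ ^ℚ_) ℚ.≤ μ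
  ∑γ≤μ n = subst (∑ n (γ ^ℚ_) ℚ.≤_) (∑γ n)
    (p≤p+q _ (*-nonNeg (0≤/ (suc (suc ℓ)) 0) (^-nonNeg 0≤γ n)))

  ∑1 : ∀ n → ∑ n (λ _ → 1ℚ) ≡ n /1+ 0
  ∑1 zero    = 0≡0/
  ∑1 (suc n) = trans (cong (ℚ._+ 1ℚ) (∑1 n)) (sym (1+/ n))

  -- Bernoulli's inequality γ^n ≥ 1 - n/μ: each of the `n` terms summed in `∑γ` is at most 1.
  γ-decay : ∀ n → μ ℚ.≤ n /1+ 0 ℚ.+ μ ℚ.* γ ^ℚ n
  γ-decay n = subst₂ ℚ._≤_ (∑γ n) (cong (ℚ._+ μ ℚ.* γ ^ℚ n) (∑1 n))
    (ℚₚ.+-monoˡ-≤ (μ ℚ.* γ ^ℚ n) (∑-mono-≤ (^≤1 0≤γ γ≤1) n))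

  -- From `n` to `suc n` the right side gains ν(β - 1)β^n = β^n ≥ 1.
  β-growth : ∀ n → n /1+ 0 ℚ.≤ ν ℚ.* β ^ℚ n
  β-growth zero    = subst (ℚ._≤ ν ℚ.* 1ℚ) 0≡0/ (*-nonNeg (0≤/ (suc ℓ) 0) 0≤1)
  β-growth (suc n) = begin
    suc n /1+ 0                     ≡⟨ 1+/ n ⟩
    n /1+ 0 ℚ.+ 1ℚ                  ≤⟨ ℚₚ.+-mono-≤ (β-growth n) (1≤^ 1≤β n) ⟩
    ν ℚ.* β ^ℚ n ℚ.+ β ^ℚ n         ≡⟨ solve 2 (λ v x → v :* x :+ x := (v :+ con 1ℚ) :* x) refl ν (β ^ℚ n) ⟩
    (ν ℚ.+ 1ℚ) ℚ.* β ^ℚ n           ≡⟨ cong (ℚ._* β ^ℚ n) (trans (sym (1+/ (suc ℓ))) (sym νβ≡μ)) ⟩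
    ν ℚ.* β ℚ.* β ^ℚ n              ≡⟨ ℚₚ.*-assoc ν β _ ⟩
    ν ℚ.* (β ℚ.* β ^ℚ n)            ∎
    where
    open ℚₚ.≤-Reasoning
    open +-*-Solver

  β-unbounded : ∀ c n → ∃[ m ] (n ℕ.≤ m × c ℚ.< β ^ℚ m)
  β-unbounded c n = m , ℕₚ.m≤m+n n _ , ℚₚ.*-cancelˡ-<-nonNeg ν {{/-nonNeg (suc ℓ) 0}} (begin-strict
    ν ℚ.* c                       ≤⟨ ℚₚ.*-monoˡ-≤-nonNeg ν {{/-nonNeg (suc ℓ) 0}} (≤↥ c) ⟩
    ν ℚ.* C /1+ 0                 ≡⟨ /-* (suc ℓ) 0 C 0 ⟩
    (suc ℓ ℕ.* C) /1+ 0           ≤⟨ ι-mono (ℕₚ.m≤n+m (suc ℓ ℕ.* C) n) ⟩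
    (n ℕ.+ suc ℓ ℕ.* C) /1+ 0     <⟨ p<p+q _ (ℚₚ.positive⁻¹ 1ℚ) ⟩
    (n ℕ.+ suc ℓ ℕ.* C) /1+ 0 ℚ.+ 1ℚ ≡⟨ sym (1+/ _) ⟩
    suc (n ℕ.+ suc ℓ ℕ.* C) /1+ 0 ≡⟨ cong (_/1+ 0) (sym (ℕₚ.+-suc n _)) ⟩
    m /1+ 0                       ≤⟨ β-growth m ⟩
    ν ℚ.* β ^ℚ m                  ∎)
    where
    open ℚₚ.≤-Reasoning
    C m : ℕ
    C = ℤ.∣ ↥ c ∣
    -- This exceeds both `n` and νC ≥ νc; `β-growth` then gives c < β^m after cancelling ν.
    m = n ℕ.+ suc (suc ℓ ℕ.* C)
    ι-mono : ∀ {a b} → a ℕ.≤ b → a /1+ 0 ℚ.≤ b /1+ 0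
    ι-mono {a} {b} a≤b = subst₂ ℚ._≤_ (∑1 a) (∑1 b) (∑-mono-bound (λ _ → 0≤1) a≤b)

  -- By `γ-decay` with μ = 4k, γ^(2k) ≥ 1 - 2k/4k = ½, and ρ^k = γ^(2k). This is what makes 2^(-1/k)
  -- ≤ ρ.
  ½≤ρ^ : ∀ k → suc (suc ℓ) ≡ k ℕ.+ k ℕ.+ (k ℕ.+ k) → ½ ℚ.≤ ρ ^ℚ k
  ½≤ρ^ k eq = subst (½ ℚ.≤_) (trans (^-homo-* γ k k) (sym (^-distrib-* γ γ k)))
    (ℚₚ.*-cancelˡ-≤-pos μ {{ℚ.positive (0</ (suc ℓ) 0)}} (subst (ℚ._≤ μ ℚ.* γ ^ℚ (k ℕ.+ k)) (sym μ½)
    (+-cancelˡ-≤ (2k /1+ 0) (subst (ℚ._≤ 2k /1+ 0 ℚ.+ μ ℚ.* γ ^ℚ 2k) 2k+2k (γ-decay 2k)))))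
    where
    2k = k ℕ.+ k
    μ½ : μ ℚ.* ½ ≡ 2k /1+ 0
    μ½ = trans (cong₂ ℚ._*_ (cong (_/1+ 0) eq) (sym 1/2≡½)) (trans (/-* (2k ℕ.+ 2k) 0 1 1)
      (/-≡ {b = 2k} {e = 0} (solve 1 (λ x → (x :+ x) :* con 1 :* con 1 := x :* con 2) refl 2k)))
      where
      open Data.Nat.Solver.+-*-Solver
    2k+2k : μ ≡ 2k /1+ 0 ℚ.+ 2k /1+ 0
    2k+2k = trans (cong (_/1+ 0) eq) (sym (trans (/-+ 2k 0 2k 0)
      (/-≡ {c = 0} {b = 2k ℕ.+ 2k} {e = 0}
        (solve 1 (λ x → (x :* con 1 :+ x :* con 1) :* con 1 := (x :+ x) :* con 1) refl 2k))))
      where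
      open Data.Nat.Solver.+-*-Solver
    +-cancelˡ-≤ : ∀ p {q s} → p ℚ.+ q ℚ.≤ p ℚ.+ s → q ℚ.≤ s
    +-cancelˡ-≤ p {q} {s} le = subst₂ ℚ._≤_ (cancel q) (cancel s) (ℚₚ.+-monoʳ-≤ (ℚ.- p) le)
      where
      cancel : ∀ x → ℚ.- p ℚ.+ (p ℚ.+ x) ≡ x
      cancel = solve 2 (λ p x → :- p :+ (p :+ x) := x) refl p
        where
        open +-*-Solver

-- The hypothesis expresses 2^(-1/(k+1)) ≤ ρ without roots. A member of the cut lies below some p
-- with p^b ≤ 2^a and a/b < -1/(k+1). Then a is negative and |a|(k+1) > b, so p^(b(k+1)) ≤
-- ½^(|a|(k+1)) ≤ ½^b ≤ ρ^(b(k+1)).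
2^-1/k≤ : ∀ {k ρ} → 0ℚ ℚ.≤ ρ → ½ ℚ.≤ ρ ^ℚ suc k →
          ∀ {p} → p ∈ lower (2^ (- fromℚ (1 /1+ k))) → p ℚ.≤ ρ
2^-1/k≤ {k} {ρ} 0≤ρ ½≤ρᵏ (p , (0≤p , t@(ℚ.mkℚ _ _ _) , (_ , (q , q∉ , refl) , t<-q) , pᵇ≤2ᵃ) , p′<p) =
  ℚₚ.≤-trans (ℚₚ.<⇒≤ p′<p) (bound (↥ t) (ℚ.denominator-1 t) num-bound pᵇ≤2ᵃ)
  where
  t<-1/k : t ℚ.< ℚ.- (1 /1+ k)
  t<-1/k = ℚₚ.<-≤-trans t<-q (ℚₚ.neg-antimono-≤ (ℚₚ.≮⇒≥ λ q< → q∉ (_ , refl , q<)))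

  num-bound : ↥ t ℤ.* + suc k ℤ.< -[1+ 0 ] ℤ.* ↧ t
  num-bound = ℚᵘₚ.drop-*<* (ℚᵘₚ.<-respʳ-≃ (-1/ k) (ℚₚ.toℚᵘ-mono-< t<-1/k))

  bound : ∀ a b → a ℤ.* + suc k ℤ.< -[1+ 0 ] ℤ.* + suc b → p ^ℚ suc b ℚ.≤ 2^ℤ a → p ℚ.≤ ρ
  bound (+ a) b lt _ =
    contradiction (subst (ℤ._< -[1+ 0 ] ℤ.* + suc b) (sym (ℤₚ.pos-* a (suc k))) lt) λ ()
  bound -[1+ a ] b (ℤ.-<- lt) pᵇ≤½ᵃ = ^-cancel-≤ (k ℕ.+ b ℕ.* suc k) 0≤ρ (begin
    p ^ℚ (suc b ℕ.* suc k)        ≡⟨ sym (^-assocʳ p (suc b) (suc k)) ⟩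
    (p ^ℚ suc b) ^ℚ suc k         ≤⟨ ^-monoˡ-≤ (^-nonNeg 0≤p (suc b)) pᵇ≤½ᵃ (suc k) ⟩
    (½ ^ℚ suc a) ^ℚ suc k         ≡⟨ ^-assocʳ ½ (suc a) (suc k) ⟩
    ½ ^ℚ (suc a ℕ.* suc k)        ≤⟨ ^-antimonoʳ-≤ 0≤½ (½^≤1 1)
                                       (ℕₚ.≤-trans (ℕ.s≤s (ℕₚ.m≤m+n b 0)) (ℕₚ.<⇒≤ (ℕ.s≤s lt))) ⟩
    ½ ^ℚ suc b                    ≤⟨ ^-monoˡ-≤ 0≤½ ½≤ρᵏ (suc b) ⟩
    (ρ ^ℚ suc k) ^ℚ suc b         ≡⟨ ^-assocʳ ρ (suc k) (suc b) ⟩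
    ρ ^ℚ (suc k ℕ.* suc b)        ≡⟨ cong (ρ ^ℚ_) (ℕₚ.*-comm (suc k) (suc b)) ⟩
    ρ ^ℚ (suc b ℕ.* suc k)        ∎)
    where
    open ℚₚ.≤-Reasoning

-- The Kronecker delta, in truncated subtraction so that it is computable by composition.
δ : ℕ → ℕ → ℕ
δ x y = 1 ∸ ((x ∸ y) ℕ.+ (y ∸ x))

δ-refl : ∀ x → δ x x ≡ 1
δ-refl x = cong (1 ∸_) (cong₂ ℕ._+_ (ℕₚ.n∸n≡0 x) (ℕₚ.n∸n≡0 x))

δ-≢ : ∀ {x y} → x ≢ y → δ x y ≡ 0
δ-≢ {x} {y} x≢y with (x ∸ y) ℕ.+ (y ∸ x) in eq
... | zero  = contradiction (ℕₚ.≤-antisym (ℕₚ.m∸n≡0⇒m≤n (ℕₚ.m+n≡0⇒m≡0 (x ∸ y) eq))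
                                          (ℕₚ.m∸n≡0⇒m≤n (ℕₚ.m+n≡0⇒n≡0 (x ∸ y) eq))) x≢y
... | suc d = ℕₚ.0∸n≡0 d

δ-computable : Computable₂ δ
δ-computable = const 1 ⊝ (proj 0F ⊝ proj 1F ⊕ (proj 1F ⊝ proj 0F))

/1-+ : ∀ a b → (a ℕ.+ b) /1+ 0 ≡ a /1+ 0 ℚ.+ b /1+ 0
/1-+ a b = sym (trans (/-+ a 0 b 0) (cong (_/1+ 0) (cong₂ ℕ._+_ (ℕₚ.*-identityʳ a) (ℕₚ.*-identityʳ b))))

1/1-* : ∀ {a} p → a ≡ 1 → a /1+ 0 ℚ.* p ≡ p
1/1-* p refl = trans (cong (ℚ._* p) (sym 1≡1/)) (ℚₚ.*-identityˡ p)

0/1-* : ∀ {a} p → a ≡ 0 → a /1+ 0 ℚ.* p ≡ 0ℚ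
0/1-* p refl = trans (cong (ℚ._* p) (sym 0≡0/)) (ℚₚ.*-zeroˡ p)

term≤∑ℕ : ∀ f {j m} → j ℕ.< m → f j ℕ.≤ ∑ℕ m f
term≤∑ℕ f {j} {suc m} j<1+m with j ℕₚ.≟ m
... | yes refl = ℕₚ.m≤n+m (f m) (∑ℕ m f)
... | no  j≢m  = ℕₚ.≤-trans (term≤∑ℕ f (ℕₚ.≤∧≢⇒< (ℕₚ.≤-pred j<1+m) j≢m)) (ℕₚ.m≤m+n (∑ℕ m f) (f m))

-- Codes of strings

digit : Bool → ℕ
digit b = if b then 2 else 1

-- Codes list the least significant digit first, so an appended bit becomes the leading digit.
⌜∷ʳ⌝ : ∀ w b → ⌜ w ∷ʳ b ⌝ ≡ ⌜ w ⌝ ℕ.+ digit b ℕ.* 2 ℕ.^ length w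
⌜∷ʳ⌝ []      b = trans (ℕₚ.+-identityʳ (digit b)) (sym (ℕₚ.*-identityʳ (digit b)))
⌜∷ʳ⌝ (c ∷ w) b = trans (cong (λ z → digit c ℕ.+ 2 ℕ.* z) (⌜∷ʳ⌝ w b))
  (solve 4 (λ d e x y → d :+ con 2 :* (x :+ e :* y) := d :+ con 2 :* x :+ e :* (con 2 :* y)) refl
    (digit c) (digit b) ⌜ w ⌝ (2 ℕ.^ length w))
  where
  open Data.Nat.Solver.+-*-Solver

⌜applyUpTo⌝ : ∀ b n → ⌜ applyUpTo b n ⌝ ≡ ∑ℕ n (λ x → digit (b x) ℕ.* 2 ℕ.^ x)
⌜applyUpTo⌝ b zero    = refl
⌜applyUpTo⌝ b (suc n) = begin
  ⌜ applyUpTo b (suc n) ⌝                                    ≡⟨ cong ⌜_⌝ (sym (applyUpTo-∷ʳ b n)) ⟩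
  ⌜ applyUpTo b n ∷ʳ b n ⌝                                   ≡⟨ ⌜∷ʳ⌝ (applyUpTo b n) (b n) ⟩
  ⌜ applyUpTo b n ⌝ ℕ.+ digit (b n) ℕ.* 2 ℕ.^ length (applyUpTo b n)
    ≡⟨ cong₂ (λ x y → x ℕ.+ digit (b n) ℕ.* 2 ℕ.^ y) (⌜applyUpTo⌝ b n) (length-applyUpTo b n) ⟩
  ∑ℕ (suc n) (λ x → digit (b x) ℕ.* 2 ℕ.^ x)                 ∎
  where
  open ≡-Reasoning

-- The digits are 1 and 2, so the parity of a nonzero code determines the first digit, and only the
-- empty string has code 0.
⌜⌝-injective : ∀ w w′ → ⌜ w ⌝ ≡ ⌜ w′ ⌝ → w ≡ w′
⌜⌝-injective []          []           eq = refl
⌜⌝-injective []          (true ∷ _)   ()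
⌜⌝-injective []          (false ∷ _)  ()
⌜⌝-injective (true ∷ _)  []           ()
⌜⌝-injective (false ∷ _) []           ()
⌜⌝-injective (true ∷ w)  (true ∷ w′)  eq =
  cong (true ∷_) (⌜⌝-injective w w′ (ℕₚ.*-cancelˡ-≡ ⌜ w ⌝ ⌜ w′ ⌝ 2
    (ℕₚ.suc-injective (ℕₚ.suc-injective eq))))
⌜⌝-injective (false ∷ w) (false ∷ w′) eq =
  cong (false ∷_) (⌜⌝-injective w w′ (ℕₚ.*-cancelˡ-≡ ⌜ w ⌝ ⌜ w′ ⌝ 2 (ℕₚ.suc-injective eq)))
⌜⌝-injective (true ∷ w)  (false ∷ w′) eq =
  contradiction (trans (ℕₚ.*-comm ⌜ w′ ⌝ 2) (sym (trans (cong suc (ℕₚ.*-comm ⌜ w ⌝ 2)) (ℕₚ.suc-injective eq))))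
    (even≢odd ⌜ w′ ⌝ ⌜ w ⌝)
  where
  even≢odd : ∀ m n → m ℕ.* 2 ≢ suc (n ℕ.* 2)
  even≢odd (suc m) (suc n) eq = even≢odd m n (ℕₚ.suc-injective (ℕₚ.suc-injective eq))
⌜⌝-injective (false ∷ w) (true ∷ w′) eq = sym (⌜⌝-injective (true ∷ w′) (false ∷ w) (sym eq))

-- Every digit is at least 1. In `capital-∑` this keeps the length of `w` within the range of
-- summation.
length≤⌜⌝ : ∀ w → length w ℕ.≤ ⌜ w ⌝
length≤⌜⌝ []      = ℕ.z≤n
length≤⌜⌝ (b ∷ w) = ℕₚ.+-mono-≤ (1≤digit b) (ℕₚ.≤-trans (length≤⌜⌝ w) (ℕₚ.m≤m+n ⌜ w ⌝ _))
  where
  1≤digit : ∀ b → 1 ℕ.≤ digit b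
  1≤digit true  = ℕ.s≤s ℕ.z≤n
  1≤digit false = ℕ.s≤s ℕ.z≤n

-- Each extension has a larger code, hence at most half the value. So `½ ^ℚ ⌜ w ⌝` is a strictly
-- positive 0-supergale.
½^-split : ∀ w → ½ ^ℚ ⌜ w ∷ʳ false ⌝ ℚ.+ ½ ^ℚ ⌜ w ∷ʳ true ⌝ ℚ.≤ ½ ^ℚ ⌜ w ⌝
½^-split w = ℚₚ.≤-trans (ℚₚ.+-mono-≤ (half false) (half true)) (ℚₚ.≤-reflexive
  (trans (solve 1 (λ x → con ½ :* x :+ con ½ :* x := con 1ℚ :* x) refl (½ ^ℚ ⌜ w ⌝)) (ℚₚ.*-identityˡ _)))
  where
  open +-*-Solver
  1≤ : ∀ b → 1 ℕ.≤ digit b ℕ.* 2 ℕ.^ length w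
  1≤ true  = ℕₚ.≤-trans (ℕₚ.m^n>0 2 (length w)) (ℕₚ.m≤m+n _ _)
  1≤ false = ℕₚ.≤-trans (ℕₚ.m^n>0 2 (length w)) (ℕₚ.m≤m+n _ _)
  half : ∀ b → ½ ^ℚ ⌜ w ∷ʳ b ⌝ ℚ.≤ ½ ℚ.* ½ ^ℚ ⌜ w ⌝
  half b = ^-antimonoʳ-≤ {m = suc ⌜ w ⌝} 0≤½ (½^≤1 1)
    (subst₂ ℕ._≤_ (ℕₚ.+-comm ⌜ w ⌝ 1) (sym (⌜∷ʳ⌝ w b)) (ℕₚ.+-monoʳ-≤ ⌜ w ⌝ (1≤ b)))

-- A single gambler

module Capital {r : ℚ} (0≤r : 0ℚ ℚ.≤ r) where

  -- The capital of the gambler who starts with 1 and stakes everything on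
  -- each next bit agreeing with b, at payoff rate r.
  capital : (ℕ → Bool) → String → ℚ
  capital b []      = 1ℚ
  capital b (c ∷ w) = if does (c Boolₚ.≟ b 0) then r ℚ.* capital (b ∘ suc) w else 0ℚ

  capital-nonNeg : ∀ b w → 0ℚ ℚ.≤ capital b w
  capital-nonNeg b []      = 0≤1
  capital-nonNeg b (c ∷ w) with c Boolₚ.≟ b 0
  ... | yes _ = *-nonNeg 0≤r (capital-nonNeg (b ∘ suc) w)
  ... | no  _ = ℚₚ.≤-refl

  -- If `w` agrees with `b`, exactly one of the two extensions still does; otherwise all terms are
  -- 0.
  capital-split : ∀ b w → capital b (w ∷ʳ false) ℚ.+ capital b (w ∷ʳ true) ≡ r ℚ.* capital b w
  capital-split b [] with b 0
  ... | false = ℚₚ.+-identityʳ _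
  ... | true  = ℚₚ.+-identityˡ _
  capital-split b (c ∷ w) with c Boolₚ.≟ b 0
  ... | yes _ = trans (sym (ℚₚ.*-distribˡ-+ r _ _)) (cong (r ℚ.*_) (capital-split (b ∘ suc) w))
  ... | no  _ = sym (ℚₚ.*-zeroʳ r)

  capital≤ : ∀ b w → capital b w ℚ.≤ r ^ℚ length w
  capital≤ b []      = ℚₚ.≤-refl
  capital≤ b (c ∷ w) with c Boolₚ.≟ b 0
  ... | yes _ = ℚₚ.*-monoˡ-≤-nonNeg r {{ℚ.nonNegative 0≤r}} (capital≤ (b ∘ suc) w)
  ... | no  _ = ^-nonNeg 0≤r (suc (length w))

  capital-agree : ∀ b S n → (∀ x → x ℕ.< n → b x ≡ S x) → capital b (applyUpTo S n) ≡ r ^ℚ n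
  capital-agree b S zero    agree = refl
  capital-agree b S (suc n) agree with S 0 Boolₚ.≟ b 0
  ... | yes _  = cong (r ℚ.*_) (capital-agree (b ∘ suc) (S ∘ suc) n (λ x x<n → agree (suc x) (ℕ.s≤s x<n)))
  ... | no  ≢b = contradiction (sym (agree 0 (ℕ.s≤s ℕ.z≤n))) ≢b

  capital-cases : ∀ b w → (applyUpTo b (length w) ≡ w × capital b w ≡ r ^ℚ length w) ⊎
                          ((∀ n → applyUpTo b n ≢ w) × capital b w ≡ 0ℚ)
  capital-cases b []      = inj₁ (refl , refl)
  capital-cases b (c ∷ w) with c Boolₚ.≟ b 0
  ... | no  c≢b  = inj₂ ((λ { (suc n) eq → c≢b (sym (∷-injectiveˡ eq)) }) , refl)
  ... | yes refl with capital-cases (b ∘ suc) w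
  ...   | inj₁ (eq , cap≡) = inj₁ (cong (b 0 ∷_) eq , cong (r ℚ.*_) cap≡)
  ...   | inj₂ (≢w , cap≡) = inj₂ ((λ { (suc n) eq → ≢w n (∷-injectiveʳ eq) }) ,
                                   trans (cong (r ℚ.*_) cap≡) (ℚₚ.*-zeroʳ r))

  -- Only n = length w can contribute, because codes are injective. The right side refers to `w` and
  -- to the prefixes of `b` through their codes alone, which makes the capital a computable function
  -- of numbers.
  capital-∑ : ∀ b w → capital b w ≡ ∑ (suc ⌜ w ⌝) (λ n → δ ⌜ applyUpTo b n ⌝ ⌜ w ⌝ /1+ 0 ℚ.* r ^ℚ n)
  capital-∑ b w with capital-cases b w
  ... | inj₁ (eq , cap≡) = trans cap≡ (sym (trans
          (∑-single others (ℕ.s≤s (length≤⌜⌝ w)))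
          (1/1-* _ (trans (cong (λ u → δ ⌜ u ⌝ ⌜ w ⌝) eq) (δ-refl ⌜ w ⌝)))))
    where
    others : ∀ n → n ≢ length w → δ ⌜ applyUpTo b n ⌝ ⌜ w ⌝ /1+ 0 ℚ.* r ^ℚ n ≡ 0ℚ
    others n n≢ = 0/1-* _ (δ-≢ λ code≡ → n≢ (trans (sym (length-applyUpTo b n))
      (cong length (⌜⌝-injective (applyUpTo b n) w code≡))))
  ... | inj₂ (≢w , cap≡) = trans cap≡ (sym (∑-zero (suc ⌜ w ⌝)
          (λ n _ → 0/1-* _ (δ-≢ λ code≡ → ≢w n (⌜⌝-injective (applyUpTo b n) w code≡)))))

-- Stages of an enumeration

module Enumeration (v : Bool) (g : ℕ → ℕ) where

  -- `unseen` and `seen` are indicators with values 0 and 1, written in arithmetic so as to be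
  -- computable; `seen` is min(1, `count`).
  count unseen seen : ℕ → ℕ → ℕ
  count  y i = ∑ℕ i (λ j → δ (g j) y)
  unseen y i = 1 ∸ count y i
  seen   y i = 1 ∸ unseen y i

  bitOf : ℕ → Bool
  bitOf zero    = not v
  bitOf (suc _) = v

  -- The characteristic sequence, at stage i, of the set enumerated so far
  -- (complemented if v is false); a value g j = x + 1 enumerates x.
  bit : ℕ → ℕ → Bool
  bit i x = bitOf (count (suc x) i)

  -- Turns a case distinction into arithmetic, for `prefixCode`.
  digit-bitOf : ∀ c → digit (bitOf c) ≡ digit (not v) ℕ.* (1 ∸ c) ℕ.+ digit v ℕ.* (1 ∸ (1 ∸ c))
  digit-bitOf zero    =
    sym (trans (cong₂ ℕ._+_ (ℕₚ.*-identityʳ (digit (not v))) (ℕₚ.*-zeroʳ (digit v))) (ℕₚ.+-identityʳ _))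
  digit-bitOf (suc c) rewrite ℕₚ.0∸n≡0 c =
    sym (cong₂ ℕ._+_ (ℕₚ.*-zeroʳ (digit (not v))) (ℕₚ.*-identityʳ (digit v)))

  -- For converting a sum over stages into a sum over values: the increment is 1 only at the first
  -- stage that enumerates `y`.
  seen-step : ∀ y i → seen y (suc i) ≡ seen y i ℕ.+ unseen (g i) i ℕ.* δ (g i) y
  seen-step y i with g i ℕₚ.≟ y
  ... | no  g≢y rewrite δ-≢ g≢y | ℕₚ.+-identityʳ (count y i) | ℕₚ.*-zeroʳ (unseen (g i) i) =
          sym (ℕₚ.+-identityʳ (seen y i))
  ... | yes refl rewrite δ-refl (g i) | ℕₚ.+-comm (count (g i) i) 1 | ℕₚ.*-identityʳ (unseen (g i) i) =
          lemma (count (g i) i)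
    where
    lemma : ∀ c → 1 ∸ (0 ∸ c) ≡ (1 ∸ (1 ∸ c)) ℕ.+ (1 ∸ c)
    lemma zero    = refl
    lemma (suc c) rewrite ℕₚ.0∸n≡0 c = refl

  count≢0 : ∀ {y i j} → j ℕ.< i → g j ≡ y → count y i ≢ 0
  count≢0 {i = i} {j} j<i refl c≡0 =
    contradiction (subst₂ ℕ._≤_ (δ-refl (g j)) c≡0 (term≤∑ℕ (λ k → δ (g k) (g j)) j<i)) λ ()

  enumerated : ∀ {y} i → count y i ≢ 0 → ∃[ j ] g j ≡ y
  enumerated zero    c≢0 = contradiction refl c≢0
  enumerated {y} (suc i) c≢0 with g i ℕₚ.≟ y
  ... | yes g≡y = i , g≡y
  ... | no  g≢y = enumerated i (λ c≡0 → c≢0 (cong₂ ℕ._+_ c≡0 (δ-≢ g≢y)))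

  -- Search backwards from stage `T` for a first occurrence of a value at most `n`. The stages
  -- skipped enumerate repeats or values above `n`, and neither changes a bit below `n`. Stage 0 is
  -- always a first occurrence, so the hypothesis on `g 0` ends the search.
  lastFresh : ∀ {n} → g 0 ℕ.≤ n → ∀ T →
              ∃[ i ] (unseen (g i) i ≡ 1 × g i ℕ.≤ n × (∀ x → x ℕ.< n → bit (suc i) x ≡ bit (suc T) x))
  lastFresh g0≤n zero = 0 , refl , g0≤n , λ _ _ → refl
  lastFresh {n} g0≤n (suc T) with count (g (suc T)) (suc T) in cnt | g (suc T) ℕₚ.≤? n
  ... | zero  | yes g≤n = suc T , cong (1 ∸_) cnt , g≤n , λ _ _ → refl
  -- To change a bit x < n, the stage would have to enumerate `suc x`, which is at most `n`.
  ... | zero  | no  g≰n =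
    let (i , fresh , gi≤n , same) = lastFresh g0≤n T in
    i , fresh , gi≤n , λ x x<n → trans (same x x<n) (cong bitOf (sym (trans
      (cong (count (suc x) (suc T) ℕ.+_) (δ-≢ λ g≡ → g≰n (subst (ℕ._≤ n) (sym g≡) x<n)))
      (ℕₚ.+-identityʳ _))))
  -- A repeat raises a count that is already positive, so `bitOf` does not change.
  ... | suc c | _       =
    let (i , fresh , gi≤n , same) = lastFresh g0≤n T in
    i , fresh , gi≤n , λ x x<n → trans (same x x<n) (unchanged x)
    where
    unchanged : ∀ x → bit (suc T) x ≡ bit (suc (suc T)) x
    unchanged x with g (suc T) ℕₚ.≟ suc x
    ... | no  g≢ = cong bitOf (sym (trans (cong (count (suc x) (suc T) ℕ.+_) (δ-≢ g≢)) (ℕₚ.+-identityʳ _)))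
    ... | yes g≡ = trans (cong bitOf cnt′) (cong (λ c → bitOf (c ℕ.+ δ (g (suc T)) (suc x))) (sym cnt′))
      where
      cnt′ : count (suc x) (suc T) ≡ suc c
      cnt′ = trans (cong (λ y → count y (suc T)) (sym g≡)) cnt

  module _ (S : Cantor) (enumerates : ∀ x → S x ≡ v ⇔ (∃[ i ] g i ≡ suc x)) where
    open module E {x} = Equivalence (enumerates x) using (to; from)

    -- The bits of `S` tell which numbers below `n` are to be awaited; `T` is the maximum over their
    -- stages.
    settled : ∀ n → ∃[ T ] (∀ x → x ℕ.< n → S x ≡ v → ∃[ j ] (j ℕ.< T × g j ≡ suc x))
    settled zero    = 0 , λ _ ()
    settled (suc n) with settled n | S n Boolₚ.≟ v
    ... | T , found | no S≢v = T , found′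
      where
      found′ : ∀ x → x ℕ.< suc n → S x ≡ v → ∃[ j ] (j ℕ.< T × g j ≡ suc x)
      found′ x x<1+n Sx≡v with x ℕₚ.≟ n
      ... | yes refl = contradiction Sx≡v S≢v
      ... | no  x≢n  = found x (ℕₚ.≤∧≢⇒< (ℕₚ.≤-pred x<1+n) x≢n) Sx≡v
    ... | T , found | yes S≡v = T ℕ.⊔ suc (proj₁ (to S≡v)) , found′
      where
      found′ : ∀ x → x ℕ.< suc n → S x ≡ v → ∃[ j ] (j ℕ.< T ℕ.⊔ suc (proj₁ (to S≡v)) × g j ≡ suc x)
      found′ x x<1+n Sx≡v with x ℕₚ.≟ n
      ... | yes refl = proj₁ (to S≡v) , ℕₚ.m≤n⊔m T _ , proj₂ (to S≡v)
      ... | no  x≢n  = let (j , j<T , g≡) = found x (ℕₚ.≤∧≢⇒< (ℕₚ.≤-pred x<1+n) x≢n) Sx≡v in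
                       j , ℕₚ.<-≤-trans j<T (ℕₚ.m≤m⊔n T _) , g≡

    -- An enumerated number is never wrong, so only a missing one could spoil a bit, and by stage
    -- `T` none below `n` is missing.
    eventually-agrees : ∀ n → ∃[ T ] (∀ x → x ℕ.< n → bit (suc T) x ≡ S x)
    eventually-agrees n = let (T , found) = settled n in T , agree T found
      where
      agree : ∀ T → (∀ x → x ℕ.< n → S x ≡ v → ∃[ j ] (j ℕ.< T × g j ≡ suc x)) →
              ∀ x → x ℕ.< n → bit (suc T) x ≡ S x
      agree T found x x<n with count (suc x) (suc T) in cnt
      ... | zero  = sym (Boolₚ.¬-not λ Sx≡v → let (j , j<T , g≡) = found x x<n Sx≡v in
                      count≢0 (ℕₚ.m<n⇒m<1+n j<T) g≡ cnt)
      ... | suc c = sym (from (enumerated (suc T) (λ c≡0 → contradiction (trans (sym cnt) c≡0) λ ())))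

-- Limits of increasing rational sequences

module Supremum (a : ℕ → ℚ) (increasing : ∀ t → a t ℚ.< a (suc t)) (b : ℚ) (a≤b : ∀ t → a t ℚ.≤ b) where

  supremum : ℝ
  supremum = sup (λ q → ∃[ t ] q ≡ a t) (a 0 , 0 , refl) (b , λ { (t , refl) → a≤b t })

  mono : ∀ {s t} → s ℕ.≤ t → a s ℚ.≤ a t
  mono {s} {zero} ℕ.z≤n = ℚₚ.≤-refl
  mono {s} {suc t} s≤1+t with s ℕₚ.≟ suc t
  ... | yes refl = ℚₚ.≤-refl
  ... | no  s≢   = ℚₚ.≤-trans (mono (ℕₚ.≤-pred (ℕₚ.≤∧≢⇒< s≤1+t s≢))) (ℚₚ.<⇒≤ (increasing t))

  -- Here the increase must be strict: `a t` lies outside its own cut but below `a (suc t)`.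
  approx<supremum : ∀ t → fromℚ (a t) < supremum
  approx<supremum t =
    a t , (λ { (_ , refl , a<a) → ℚₚ.<-irrefl refl a<a }) , a (suc t) , (suc t , refl) , increasing t

  -- The rational that separates `y` from the supremum also separates `y` from `a t`: for all large
  -- `t` if `y` is below, and for every `t` if `y` is above.
  converges : Converges a supremum
  converges =
    (λ { y (q , q∉y , _ , (T , refl) , q<aT) →
           T , λ t T≤t → q , q∉y , a t , refl , ℚₚ.<-≤-trans q<aT (mono T≤t) }) ,
    (λ { y (q , q∉sup , q∈y) →
           0 , λ t _ → q , (λ { (_ , refl , q<at) → q∉sup (a t , (t , refl) , q<at) }) , q∈y })

-- The combined supergale

module Supergale (ℓ : ℕ) (v : Bool) (g : ℕ → ℕ)
                 (g-computable : Computable {1} (λ xs → g (lookup xs 0F))) where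
  open Base ℓ
  open Capital 0≤r
  open Enumeration v g

  stake : ℕ → ℚ
  stake i = unseen (g i) i /1+ 0 ℚ.* γ ^ℚ g i

  -- The second summand only serves to make approx strictly increasing.
  term : String → ℕ → ℚ
  term w i = stake i ℚ.* capital (bit (suc i)) w ℚ.+ γ ^ℚ i ℚ.* ½ ^ℚ ⌜ w ⌝

  approx : String → ℕ → ℚ
  approx w t = ∑ t (term w)

  stake-nonNeg : ∀ i → 0ℚ ℚ.≤ stake i
  stake-nonNeg i = *-nonNeg (0≤/ (unseen (g i) i) 0) (^-nonNeg 0≤γ (g i))

  filler-pos : ∀ w i → 0ℚ ℚ.< γ ^ℚ i ℚ.* ½ ^ℚ ⌜ w ⌝
  filler-pos w i = ℚₚ.positive⁻¹ _ {{ℚₚ.pos*pos⇒pos (γ ^ℚ i) {{ℚ.positive (^-pos 0<γ i)}}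
    (½ ^ℚ ⌜ w ⌝) {{ℚ.positive (^-pos (ℚₚ.positive⁻¹ ½) ⌜ w ⌝)}}}}

  bet-nonNeg : ∀ w i → 0ℚ ℚ.≤ stake i ℚ.* capital (bit (suc i)) w
  bet-nonNeg w i = *-nonNeg (stake-nonNeg i) (capital-nonNeg (bit (suc i)) w)

  term-pos : ∀ w i → 0ℚ ℚ.< term w i
  term-pos w i = ℚₚ.+-mono-≤-< (bet-nonNeg w i) (filler-pos w i)

  approx-increasing : ∀ w t → approx w t ℚ.< approx w (suc t)
  approx-increasing w t = p<p+q (approx w t) (term-pos w t)

  -- Summed over both extensions, the bet grows by exactly `r`; the filler does not grow, which
  -- suffices because r ≥ 1.
  term-split : ∀ w i → term (w ∷ʳ false) i ℚ.+ term (w ∷ʳ true) i ℚ.≤ r ℚ.* term w i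
  term-split w i = begin
    (s ℚ.* c₀ ℚ.+ x ℚ.* h₀) ℚ.+ (s ℚ.* c₁ ℚ.+ x ℚ.* h₁)
      ≡⟨ solve 6 (λ s x c d h k → (s :* c :+ x :* h) :+ (s :* d :+ x :* k) := s :* (c :+ d) :+ x :* (h :+ k)) refl
           s x c₀ c₁ h₀ h₁ ⟩
    s ℚ.* (c₀ ℚ.+ c₁) ℚ.+ x ℚ.* (h₀ ℚ.+ h₁)
      ≤⟨ ℚₚ.+-mono-≤ (ℚₚ.≤-reflexive (cong (s ℚ.*_) (capital-split (bit (suc i)) w)))
           (ℚₚ.*-monoˡ-≤-nonNeg x {{ℚ.nonNegative (^-nonNeg 0≤γ i)}} (ℚₚ.≤-trans (½^-split w) h≤rh)) ⟩
    s ℚ.* (r ℚ.* c) ℚ.+ x ℚ.* (r ℚ.* h)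
      ≡⟨ solve 5 (λ s x c h r → s :* (r :* c) :+ x :* (r :* h) := r :* (s :* c :+ x :* h)) refl s x c h r ⟩
    r ℚ.* (s ℚ.* c ℚ.+ x ℚ.* h) ∎
    where
    open ℚₚ.≤-Reasoning
    open +-*-Solver
    s = stake i
    x = γ ^ℚ i
    c = capital (bit (suc i)) w
    c₀ = capital (bit (suc i)) (w ∷ʳ false)
    c₁ = capital (bit (suc i)) (w ∷ʳ true)
    h = ½ ^ℚ ⌜ w ⌝
    h₀ = ½ ^ℚ ⌜ w ∷ʳ false ⌝
    h₁ = ½ ^ℚ ⌜ w ∷ʳ true ⌝
    h≤rh : h ℚ.≤ r ℚ.* h
    h≤rh = subst (ℚ._≤ r ℚ.* h) (ℚₚ.*-identityˡ h)
      (ℚₚ.*-monoʳ-≤-nonNeg h {{ℚ.nonNegative (^-nonNeg 0≤½ ⌜ w ⌝)}}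
        (*-mono {1ℚ} {β} {1ℚ} {β} 0≤1 0≤β 1≤β 1≤β))

  approx-split : ∀ w t → approx (w ∷ʳ false) t ℚ.+ approx (w ∷ʳ true) t ℚ.≤ r ℚ.* approx w t
  approx-split w t = subst₂ ℚ._≤_ (∑-distrib-+ (term (w ∷ʳ false)) (term (w ∷ʳ true)) t)
    (sym (*-distribˡ-∑ r (term w) t)) (∑-mono-≤ (term-split w) t)

  -- A nonzero stake belongs to the first occurrence of its value, so the sum can be reindexed by
  -- the values seen. By `seen-step`, stage `t` affects only the summand at y = g t.
  ∑stake≡ : ∀ Y t → (∀ i → i ℕ.< t → g i ℕ.< Y) → ∑ t stake ≡ ∑ Y (λ y → seen y t /1+ 0 ℚ.* γ ^ℚ y)
  ∑stake≡ Y zero    g<Y = sym (∑-zero Y (λ y _ → 0/1-* (γ ^ℚ y) refl))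
  ∑stake≡ Y (suc t) g<Y = begin
    ∑ t stake ℚ.+ stake t
      ≡⟨ cong₂ ℚ._+_ (∑stake≡ Y t (λ i i<t → g<Y i (ℕₚ.m<n⇒m<1+n i<t)))
           (trans (cong (λ z → z /1+ 0 ℚ.* γ ^ℚ g t)
                    (sym (trans (cong (u ℕ.*_) (δ-refl (g t))) (ℕₚ.*-identityʳ u))))
             (sym (∑-single (λ y y≢g → 0/1-* (γ ^ℚ y)
                      (trans (cong (u ℕ.*_) (δ-≢ (λ g≡y → y≢g (sym g≡y)))) (ℕₚ.*-zeroʳ u)))
                    (g<Y t ℕₚ.≤-refl)))) ⟩
    ∑ Y (λ y → seen y t /1+ 0 ℚ.* γ ^ℚ y) ℚ.+ ∑ Y (λ y → (u ℕ.* δ (g t) y) /1+ 0 ℚ.* γ ^ℚ y)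
      ≡⟨ sym (∑-distrib-+ _ _ Y) ⟩
    ∑ Y (λ y → seen y t /1+ 0 ℚ.* γ ^ℚ y ℚ.+ (u ℕ.* δ (g t) y) /1+ 0 ℚ.* γ ^ℚ y)
      ≡⟨ ∑-cong (λ y → trans (sym (ℚₚ.*-distribʳ-+ (γ ^ℚ y) (seen y t /1+ 0) ((u ℕ.* δ (g t) y) /1+ 0)))
           (cong (ℚ._* γ ^ℚ y) (trans (sym (/1-+ (seen y t) (u ℕ.* δ (g t) y)))
              (cong (_/1+ 0) (sym (seen-step y t)))))) Y ⟩
    ∑ Y (λ y → seen y (suc t) /1+ 0 ℚ.* γ ^ℚ y) ∎
    where
    open ≡-Reasoning
    u = unseen (g t) t

  ∑stake≤μ : ∀ t → ∑ t stake ℚ.≤ μ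
  -- The cutoff `suc (∑ℕ t g)` exceeds every value enumerated before stage `t`.
  ∑stake≤μ t = ℚₚ.≤-trans (ℚₚ.≤-reflexive (∑stake≡ (suc (∑ℕ t g)) t (λ i i<t → ℕ.s≤s (term≤∑ℕ g i<t))))
    (ℚₚ.≤-trans (∑-mono-≤ (λ y → seen* y (unseen y t)) (suc (∑ℕ t g))) (∑γ≤μ (suc (∑ℕ t g))))
    where
    seen* : ∀ y c → (1 ∸ c) /1+ 0 ℚ.* γ ^ℚ y ℚ.≤ γ ^ℚ y
    seen* y zero    = ℚₚ.≤-reflexive (1/1-* (γ ^ℚ y) refl)
    seen* y (suc c) = subst (ℚ._≤ γ ^ℚ y) (sym (0/1-* (γ ^ℚ y) (ℕₚ.0∸n≡0 c))) (^-nonNeg 0≤γ y)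

  -- The stakes total at most `μ` and each is multiplied by at most `r ^ℚ length w`; the second `μ`
  -- bounds the filler.
  bound : String → ℚ
  bound w = r ^ℚ length w ℚ.* μ ℚ.+ μ

  approx≤bound : ∀ w t → approx w t ℚ.≤ bound w
  approx≤bound w t = begin
    ∑ t (term w)                                       ≤⟨ ∑-mono-≤ term≤ t ⟩
    ∑ t (λ i → R ℚ.* stake i ℚ.+ γ ^ℚ i)               ≡⟨ ∑-distrib-+ _ _ t ⟩
    ∑ t (λ i → R ℚ.* stake i) ℚ.+ ∑ t (γ ^ℚ_)          ≡⟨ cong (ℚ._+ ∑ t (γ ^ℚ_)) (sym (*-distribˡ-∑ R stake t)) ⟩
    R ℚ.* ∑ t stake ℚ.+ ∑ t (γ ^ℚ_)
      ≤⟨ ℚₚ.+-mono-≤ (ℚₚ.*-monoˡ-≤-nonNeg R {{ℚ.nonNegative (^-nonNeg 0≤r (length w))}} (∑stake≤μ t))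
           (∑γ≤μ t) ⟩
    R ℚ.* μ ℚ.+ μ                                      ∎
    where
    open ℚₚ.≤-Reasoning
    R = r ^ℚ length w
    term≤ : ∀ i → term w i ℚ.≤ R ℚ.* stake i ℚ.+ γ ^ℚ i
    term≤ i = ℚₚ.+-mono-≤
      (subst (stake i ℚ.* capital (bit (suc i)) w ℚ.≤_) (ℚₚ.*-comm (stake i) R)
        (ℚₚ.*-monoˡ-≤-nonNeg (stake i) {{ℚ.nonNegative (stake-nonNeg i)}} (capital≤ (bit (suc i)) w)))
      (subst (γ ^ℚ i ℚ.* ½ ^ℚ ⌜ w ⌝ ℚ.≤_) (ℚₚ.*-identityʳ (γ ^ℚ i))
        (ℚₚ.*-monoˡ-≤-nonNeg (γ ^ℚ i) {{ℚ.nonNegative (^-nonNeg 0≤γ i)}} (½^≤1 ⌜ w ⌝)))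

  module Limit (w : String) = Supremum (approx w) (approx-increasing w) (bound w) (approx≤bound w)

  d : String → ℝ
  d w = Limit.supremum w

  -- The two extensions may be approximated at different stages. At the maximum `t` of these,
  -- `approx-split` gives a factor `r`, which 2^(-1/(k+1)) ≤ ρ = 1/r cancels.
  d-supergale : ∀ {k} → ½ ℚ.≤ ρ ^ℚ suc k → IsSupergale (fromℚ (1 /1+ k)) d
  d-supergale {k} ½≤ρᵏ = record { nonNegative = 0≤d ; average = average }
    where
    0≤d : ∀ w → 0ℝ ≤ d w
    0≤d w (_ , refl , q<0) = 0ℚ , (0 , refl) , q<0

    average : ∀ w → 2^ (- fromℚ (1 /1+ k)) * (d (w ∷ʳ false) + d (w ∷ʳ true)) ≤ d w
    -- Below the default value 0 of a product, `approx w 0` = 0 already suffices.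
    average w (_ , inj₁ refl , q<0) = 0ℚ , (0 , refl) , q<0
    average w (_ , inj₂ (p , e , p∈ ,
                 (_ , (e₀ , e₁ , (_ , (t₀ , refl) , e₀<) , (_ , (t₁ , refl) , e₁<) , refl) , e<) ,
                 0≤p , 0≤e , refl) , q<) =
      approx w t , (t , refl) , ℚₚ.<-≤-trans q< (begin
        p ℚ.* e
          ≤⟨ *-mono 0≤p (*-nonNeg 0≤r (∑-nonNeg (λ i → ℚₚ.<⇒≤ (term-pos w i)) t))
               (2^-1/k≤ 0≤ρ ½≤ρᵏ p∈) e≤ ⟩
        ρ ℚ.* (r ℚ.* approx w t)
          ≡⟨ sym (ℚₚ.*-assoc ρ r _) ⟩
        ρ ℚ.* r ℚ.* approx w t
          ≡⟨ cong (ℚ._* approx w t) ρr≡1 ⟩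
        1ℚ ℚ.* approx w t
          ≡⟨ ℚₚ.*-identityˡ _ ⟩
        approx w t ∎)
      where
      open ℚₚ.≤-Reasoning
      t = t₀ ℕ.⊔ t₁
      e≤ : e ℚ.≤ r ℚ.* approx w t
      e≤ = begin
        e
          <⟨ e< ⟩
        e₀ ℚ.+ e₁
          <⟨ ℚₚ.+-mono-< e₀< e₁< ⟩
        approx (w ∷ʳ false) t₀ ℚ.+ approx (w ∷ʳ true) t₁
          ≤⟨ ℚₚ.+-mono-≤ (Limit.mono (w ∷ʳ false) (ℕₚ.m≤m⊔n t₀ t₁))
               (Limit.mono (w ∷ʳ true) (ℕₚ.m≤n⊔m t₀ t₁)) ⟩
        approx (w ∷ʳ false) t ℚ.+ approx (w ∷ʳ true) t
          ≤⟨ approx-split w t ⟩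
        r ℚ.* approx w t ∎

  -- Computability of the approximations

  count-computable : Computable₂ (λ i y → count y i)
  count-computable = primrec (const 0)
    (proj 1F ⊕ apply₂ δ δ-computable (apply₁ g g-computable (proj 0F)) (proj 2F))
    (λ _ → refl) (λ _ _ → refl)

  -- The digits are those of `digit-bitOf`: with arithmetic in place of Booleans, the closure
  -- properties of computable functions apply.
  prefixCode : ℕ → ℕ → ℕ
  prefixCode n i = ∑ℕ n (λ x → (digit (not v) ℕ.* (1 ∸ count (suc x) i)
                                ℕ.+ digit v ℕ.* (1 ∸ (1 ∸ count (suc x) i))) ℕ.* 2 ℕ.^ x)

  prefixCode≡ : ∀ n i → prefixCode n i ≡ ⌜ applyUpTo (bit i) n ⌝
  prefixCode≡ n i = trans (∑ℕ-cong n) (sym (⌜applyUpTo⌝ (bit i) n))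
    where
    ∑ℕ-cong : ∀ n → prefixCode n i ≡ ∑ℕ n (λ x → digit (bit i x) ℕ.* 2 ℕ.^ x)
    ∑ℕ-cong zero    = refl
    ∑ℕ-cong (suc n) = cong₂ ℕ._+_ (∑ℕ-cong n) (cong (ℕ._* 2 ℕ.^ n) (sym (digit-bitOf (count (suc n) i))))

  prefixCode-computable : Computable₂ prefixCode
  prefixCode-computable = primrec (const 0)
    (proj 1F ⊕ (const (digit (not v)) ⊛ (const 1 ⊝ c) ⊕ const (digit v) ⊛ (const 1 ⊝ (const 1 ⊝ c)))
               ⊛ apply₁ (2 ℕ.^_) 2^-computable (proj 0F))
    (λ _ → refl) (λ _ _ → refl)
    where
    c : Computable {3} (λ xs → count (suc (lookup xs 0F)) (lookup xs 2F))
    c = apply₂ (λ i y → count y i) count-computable (proj 2F) (suc-computable (proj 0F))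

    2^-computable : Computable {1} (λ xs → 2 ℕ.^ lookup xs 0F)
    2^-computable = primrec (const 1) (const 2 ⊛ proj 1F) (λ _ → refl) (λ _ _ → refl)

  -- The sum of `capital-∑`, with the string given by its code `c`.
  codedCapital : ℕ → ℕ → ℕ → ℚ
  codedCapital m i c = ∑ m (λ n → δ (prefixCode n i) c /1+ 0 ℚ.* r ^ℚ n)

  codedTerm : ℕ → ℕ → ℚ
  codedTerm c i = stake i ℚ.* codedCapital (suc c) (suc i) c ℚ.+ γ ^ℚ i ℚ.* ½ ^ℚ c

  term≡ : ∀ w i → term w i ≡ codedTerm ⌜ w ⌝ i
  term≡ w i = cong (λ z → stake i ℚ.* z ℚ.+ γ ^ℚ i ℚ.* ½ ^ℚ ⌜ w ⌝) (trans (capital-∑ (bit (suc i)) w)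
    (∑-cong (λ n → cong (λ z → δ z ⌜ w ⌝ /1+ 0 ℚ.* r ^ℚ n) (sym (prefixCode≡ n (suc i)))) (suc ⌜ w ⌝)))

  approx-computable : Computable⁺ {2} (λ xs → ∑ (lookup xs 1F) (codedTerm (lookup xs 0F)))
  approx-computable = compose⁺ (sum⁺ {q = λ xs → codedTerm (lookup xs 1F) (lookup xs 0F)}
      (frac (const 1 ⊝ apply₂ (λ i y → count y i) count-computable (proj 0F) g₀) 0
       ⊛⁺ power⁺ (suc ℓ) (suc ℓ) g₀
       ⊛⁺ compose⁺ (sum⁺ {q = λ xs → δ (prefixCode (lookup xs 0F) (lookup xs 1F)) (lookup xs 2F) /1+ 0
                                     ℚ.* r ^ℚ lookup xs 0F}
            (frac (apply₂ δ δ-computable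
                    (apply₂ prefixCode prefixCode-computable (proj 0F) (proj 1F)) (proj 2F)) 0 ⊛⁺ r^))
            (suc-computable (proj 1F) ∷ suc-computable (proj 0F) ∷ proj 1F ∷ [])
       ⊕⁺ power⁺ (suc ℓ) (suc ℓ) (proj 0F) ⊛⁺ ½^))
    -- `sum⁺` expects the bound first, `Computableℚ` the string.
    (proj 1F ∷ proj 0F ∷ [])
    where
    g₀ : Computable {2} (λ xs → g (lookup xs 0F))
    g₀ = apply₁ g g-computable (proj 0F)

    r^ : Computable⁺ {3} (λ xs → r ^ℚ lookup xs 0F)
    r^ = subst (λ z → Computable⁺ {3} (λ xs → z ^ℚ lookup xs 0F))
           (sym (/-* (suc (suc ℓ)) ℓ (suc (suc ℓ)) ℓ)) (power⁺ _ _ (proj 0F))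

    ½^ : Computable⁺ {2} (λ xs → ½ ^ℚ lookup xs 1F)
    ½^ = subst (λ z → Computable⁺ {2} (λ xs → z ^ℚ lookup xs 1F)) 1/2≡½ (power⁺ 1 1 (proj 1F))

  opaque
    unfolding _/1+_

    computableℚ : Computableℚ approx
    -- The approximations are nonnegative, so the subtrahend is 0.
    computableℚ = Computable⁺.num approx-computable , (λ _ → 0) , Computable⁺.den approx-computable ,
      Computable⁺.num-computable approx-computable , const 0 , Computable⁺.den-computable approx-computable ,
      λ w t → trans (∑-cong (term≡ w) t) (Computable⁺.fraction approx-computable (⌜ w ⌝ ∷ t ∷ []))

  d-lowerSemicomputable : LowerSemicomputable d
  d-lowerSemicomputable = record
    { approx     = approx
    ; computable = computableℚ
    ; monotone   = λ w t → ℚₚ.<⇒≤ (approx-increasing w t)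
    ; below      = λ w → Limit.approx<supremum w
    ; converges  = λ w → Limit.converges w
    }

  -- Success on `S`

  module _ (S : Cantor) (enumerates : ∀ x → S x ≡ v ⇔ (∃[ i ] g i ≡ suc x)) where

    -- The gambler of the stage `i` found by `lastFresh` predicts all `n` bits correctly and reaches
    -- r^n γ^g(i), at least (r γ)^n = β^n since g(i) ≤ n.
    β^≤approx : ∀ n → g 0 ℕ.≤ n → ∃[ t ] β ^ℚ n ℚ.≤ approx (S [0‥ n -1]) t
    β^≤approx n g0≤n =
      let (T , agrees) = eventually-agrees S enumerates n
          (i , fresh , gi≤n , same) = lastFresh g0≤n T
      in suc i , (begin
        β ^ℚ n                          ≡⟨ cong (_^ℚ n) (sym γr≡β) ⟩
        (γ ℚ.* r) ^ℚ n                  ≡⟨ ^-distrib-* γ r n ⟩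
        γ ^ℚ n ℚ.* r ^ℚ n               ≤⟨ ℚₚ.*-monoʳ-≤-nonNeg (r ^ℚ n) {{ℚ.nonNegative (^-nonNeg 0≤r n)}}
                                             (^-antimonoʳ-≤ 0≤γ γ≤1 gi≤n) ⟩
        γ ^ℚ g i ℚ.* r ^ℚ n             ≡⟨ sym (cong₂ ℚ._*_ (1/1-* (γ ^ℚ g i) fresh)
                                             (capital-agree (bit (suc i)) S n
                                               (λ x x<n → trans (same x x<n) (agrees x x<n)))) ⟩
        stake i ℚ.* capital (bit (suc i)) (S [0‥ n -1])
                                        ≤⟨ p≤p+q _ (ℚₚ.<⇒≤ (filler-pos (S [0‥ n -1]) i)) ⟩
        term (S [0‥ n -1]) i            ≤⟨ term≤∑ (λ j → ℚₚ.<⇒≤ (term-pos (S [0‥ n -1]) j)) ℕₚ.≤-refl ⟩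
        approx (S [0‥ n -1]) (suc i)    ∎)
      where
      open ℚₚ.≤-Reasoning
      γr≡β : γ ℚ.* r ≡ β
      γr≡β = trans (sym (ℚₚ.*-assoc γ β β)) (trans (cong (ℚ._* β) γβ≡1) (ℚₚ.*-identityˡ β))

    d-succeeds : S ∈ S^∞[ d ]
    d-succeeds y n =
      let (c , c∉y) = proper y
          -- The prefix must also be long enough for `lastFresh`, which needs g 0 ≤ m.
          (m , n⊔g0≤m , c<βᵐ) = β-unbounded c (n ℕ.⊔ g 0)
          (t , βᵐ≤) = β^≤approx m (ℕₚ.≤-trans (ℕₚ.m≤n⊔m n (g 0)) n⊔g0≤m)
      in m , ℕₚ.≤-trans (ℕₚ.m≤m⊔n n (g 0)) n⊔g0≤m , c , c∉y , _ , (t , refl) , ℚₚ.<-≤-trans c<βᵐ βᵐ≤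

-- Dimension zero

enumeration : ∀ {S : Cantor} {v} → ComputablyEnumerable (λ n → S n ≡ v) →
              ∃[ g ] (Computable {1} (λ xs → g (lookup xs 0F)) × (∀ x → S x ≡ v ⇔ (∃[ i ] g i ≡ suc x)))
enumeration (inj₁ empty) =
  -- Shifting all values by one leaves 0 as a dummy, so that the empty set also has a total
  -- enumeration.
  (λ _ → 0) , const 0 , λ x → mk⇔ (λ Sx → contradiction Sx (empty x)) λ ()
enumeration (inj₂ (f , f-computable , f-enumerates)) =
  (λ i → suc (f (i ∷ []))) , suc-computable (compose f-computable (proj 0F ∷ [])) , λ x →
  mk⇔ (λ Sx → let (i , f≡) = Equivalence.to (f-enumerates x) Sx in i , cong suc f≡)
      (λ (i , g≡) → Equivalence.from (f-enumerates x) (i , ℕₚ.suc-injective g≡))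

admissible : ∀ {S v} → ComputablyEnumerable (λ n → S n ≡ v) →
             ∀ k → CdimAdmissible (S ≗_) (fromℚ (1 /1+ k))
admissible {S} {v} ce k =
  let (g , g-computable , enumerates) = enumeration ce
      -- With this choice μ = 4(k + 1), as `½≤ρ^` requires at `suc k`.
      open Supergale (2 ℕ.+ 4 ℕ.* k) v g g-computable
  in (λ (_ , q≡ , q<) → 1 /1+ k , refl , ℚₚ.<-trans q< (subst (ℚ._< 1 /1+ k) (sym q≡) (0</ 0 k))) ,
     d , d-supergale (Base.½≤ρ^ (2 ℕ.+ 4 ℕ.* k) (suc k) 4+4k) , d-lowerSemicomputable ,
     -- `S′` has the same bits as `S`, so `g` enumerates it as well.
     λ S′ S≗S′ → d-succeeds S′ (λ x → mk⇔
       (λ S′x → Equivalence.to (enumerates x) (trans (S≗S′ x) S′x))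
       (λ ∃i → trans (sym (S≗S′ x)) (Equivalence.from (enumerates x) ∃i)))
  where
  4+4k : 4 ℕ.+ 4 ℕ.* k ≡ suc k ℕ.+ suc k ℕ.+ (suc k ℕ.+ suc k)
  4+4k = solve 1 (λ k → con 4 :+ con 4 :* k
                        := con 1 :+ k :+ (con 1 :+ k) :+ (con 1 :+ k :+ (con 1 :+ k))) refl k
    where
    open Data.Nat.Solver.+-*-Solver

-- Admissible s are nonnegative by definition. Conversely, a lower bound `y` with a nonnegative
-- rational in its cut would exceed some admissible 1/(k+1).
dim≐0 : ∀ {S v} → ComputablyEnumerable (λ n → S n ≡ v) → dim S ≐ 0ℝ
dim≐0 ce = record
  { lowerBound = λ _ → proj₁
  ; greatest   = λ y y≤ {q} q∈y → 0ℚ , refl , ℚₚ.≰⇒> λ 0≤q →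
      -- `q` may be 0, whereas the larger `q′` is positive and so at least some 1/(k+1).
      let (q′ , q<q′ , q′∈y) = open′ y q∈y
          (k , 1/k≤q′) = 1/1+≤ (ℚₚ.≤-<-trans 0≤q q<q′)
          (_ , q≡ , q′<1/k) = y≤ _ (admissible ce k) q′∈y
      in ℚₚ.<-irrefl refl (ℚₚ.<-≤-trans (subst (q′ ℚ.<_) q≡ q′<1/k) 1/k≤q′)
  }

theorem4p6 : (S : Cantor) → Σ⁰₁ S ⊎ Π⁰₁ S → dim S ≐ 0ℝ
theorem4p6 S (inj₁ ce) = dim≐0 ce
theorem4p6 S (inj₂ ce) = dim≐0 ce
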